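{- Let $M=\{1^{k_{1}},2^{k_{2}},\ldots,m^{k_{m}}\}$ with $k_{i}\geq1$ for all $i\in[m]$, and let $\tau$ be a consecutive permutation of $[m]$. Then for every positive integer $d$, \[ \sum_{w\in\mathfrak{S}_{M}^{\tau}}q^{\mathrm{INV}(w)}=\sum_{w\in\mathfrak{S}_{M}^{\tau}}q^{\mathrm{MAJ}(w)}=\sum_{w\in\mathfrak{S}_{M}^{\tau}}q^{\mathrm{MAJ}_{d}(w)}=\sum_{w\in\mathfrak{S}_{M}^{\tau}}q^{\mathrm{Z}(w)}. \]
   Context: $\mathfrak{S}_M$ is the set of words $w=w_1\cdots w_n$ that are rearrangements of the multiset $M$ ($k_i$ copies of $i$, $n=\sum k_i$). The tail permutation of $w$ is the subword $w_{t_1}\cdots w_{t_m}$ ($t_1<\dots<t_m$) formed by the last (rightmost) occurrences of the letters; it is a permutation of $[m]$. $\mathfrak{S}_M^\tau$ is the set of $w\in\mathfrak{S}_M$ with tail permutation $\tau$. A permutation $\tau_1\cdots\tau_m$ of $[m]$ is consecutive if $\{\tau_1,\dots,\tau_i\}$ is a set of consecutive integers for every $i\in[m]$. Statistics: $\mathrm{INV}(w)=|\{(i,j):i<j,w_i>w_j\}|$; $\mathrm{MAJ}(w)=\sum_{i:w_i>w_{i+1}}i$; $\mathrm{MAJ}_d(w)=|\{(i,j):i<j<i+d,\ w_i>w_j\}|+\sum_{i:\,w_i>w_{i+d}}i$; $\mathrm{Z}(w)=\sum_{i<j}\mathrm{MAJ}(w_{ij})$, where $w_{ij}$ is the subword of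 $w$ consisting of the letters equal to $i$ or $j$. -}

module Defs where

open import Data.Bool using (Bool; true; false; _∧_; _∨_; if_then_else_)
open import Data.Nat using (ℕ; zero; suc; _+_; _≤_; _<_; _≡ᵇ_; _<ᵇ_)
open import Data.Fin using (Fin; toℕ)
open import Data.List using (List; []; _∷_; length; map; filterᵇ; concatMap; allFin; upTo; take)
open import Data.Nat.ListAction using (sum)
open import Data.Bool.ListAction using (any; all)
open import Data.Maybe using (Maybe; just; nothing)
open import Data.List.Membership.Propositional using (_∈_)
open import Data.Product using (_×_; _,_)
open import Relation.Binary.PropositionalEquality using (_≡_)

-- Letters: Fin m, where the Fin value a stands for the letter (toℕ a + 1) ∈ [m].
-- The order on letters is the order of toℕ.

Word : ℕ → Set
Word m = List (Fin m)

eqL : ∀ {m} → Fin m → Fin m → Bool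
eqL a b = toℕ a ≡ᵇ toℕ b

mult : ∀ {m} → Fin m → Word m → ℕ
mult a w = length (filterᵇ (eqL a) w)

allWords : (m n : ℕ) → List (Word m)
allWords m zero    = [] ∷ []
allWords m (suc n) = concatMap (λ x → map (x ∷_) (allWords m n)) (allFin m)

size : (m : ℕ) → (Fin m → ℕ) → ℕ
size m k = sum (map k (allFin m))

isRearr : (m : ℕ) → (Fin m → ℕ) → Word m → Bool
isRearr m k w = all (λ a → mult a w ≡ᵇ k a) (allFin m)

tailPerm : ∀ {m} → Word m → Word m
tailPerm []       = []
tailPerm (x ∷ xs) = if any (eqL x) xs then tailPerm xs else x ∷ tailPerm xs

eqWord : ∀ {m} → Word m → Word m → Bool
eqWord []       []       = true
eqWord (x ∷ xs) (y ∷ ys) = eqL x y ∧ eqWord xs ys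
eqWord _        _        = false

-- 𝔖_M^τ, as a (duplicate-free) list enumerating its elements
SMτ : (m : ℕ) → (Fin m → ℕ) → Word m → List (Word m)
SMτ m k τ = filterᵇ (λ w → isRearr m k w ∧ eqWord (tailPerm w) τ) (allWords m (size m k))

IsPerm : (m : ℕ) → Word m → Set
IsPerm m τ = (length τ ≡ m) × (∀ (a : Fin m) → a ∈ τ)

Consecutive : (m : ℕ) → Word m → Set
Consecutive m τ = ∀ (i : ℕ) (a b c : Fin m) → a ∈ take i τ → c ∈ take i τ →
  toℕ a ≤ toℕ b → toℕ b ≤ toℕ c → b ∈ take i τ

-- 1-indexed access w_i
at : ∀ {m} → Word m → ℕ → Maybe (Fin m)
at []       _             = nothing
at (x ∷ xs) zero          = nothing
at (x ∷ xs) (suc zero)    = just x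
at (x ∷ xs) (suc (suc i)) = at xs (suc i)

gtAt : ∀ {m} → Word m → ℕ → ℕ → Bool
gtAt w i j with at w i | at w j
... | just a | just b = toℕ b <ᵇ toℕ a
... | _      | _      = false

pos : ℕ → List ℕ
pos n = map suc (upTo n)

pairs : ℕ → List (ℕ × ℕ)
pairs n = concatMap (λ i → map (i ,_) (pos n)) (pos n)

countᵇ : ∀ {A : Set} → (A → Bool) → List A → ℕ
countᵇ p xs = length (filterᵇ p xs)

INV : ∀ {m} → Word m → ℕ
INV w = countᵇ (λ { (i , j) → (i <ᵇ j) ∧ gtAt w i j }) (pairs (length w))

MAJ : ∀ {m} → Word m → ℕ
MAJ w = sum (map (λ i → if gtAt w i (suc i) then i else 0) (pos (length w)))

MAJd : ℕ → ∀ {m} → Word m → ℕ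
MAJd d w =
  countᵇ (λ { (i , j) → (i <ᵇ j) ∧ (j <ᵇ i + d) ∧ gtAt w i j }) (pairs (length w))
  + sum (map (λ i → if gtAt w i (i + d) then i else 0) (pos (length w)))

sub : ∀ {m} → Fin m → Fin m → Word m → Word m
sub a b w = filterᵇ (λ x → eqL x a ∨ eqL x b) w

Z : ∀ {m} → Word m → ℕ
Z {m} w = sum (concatMap (λ a → map (λ b → if toℕ a <ᵇ toℕ b then MAJ (sub a b w) else 0)
                                     (allFin m)) (allFin m))

-- coefficient of q^e in Σ_{w ∈ 𝔖_M^τ} q^{stat(w)}
coeff : (m : ℕ) → (Fin m → ℕ) → Word m → (Word m → ℕ) → ℕ → ℕ
coeff m k τ stat e = countᵇ (λ w → stat w ≡ᵇ e) (SMτ m k τ)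

{-# OPTIONS --safe #-}

-- Words are read from their right end, so that the tail permutation becomes the
-- order of first occurrences.
--
-- INV and MAJ_d: Foata's bijection, with the block shifts applied only to
-- letters at distance at least d from the appended one (Kadell), turns MAJ_d
-- into INV.
-- Appending x shifts blocks of letters > x against letters ≤ x, so an interval
-- of letters not containing x keeps its internal order.  Hence the last letter
-- of w restricted to any interval is preserved, and for consecutive τ these
-- letters determine the tail permutation.
--
-- INV and Z: write k_b for the multiplicity of b and s_i for the sum of the
-- multiplicities of τ_1, …, τ_i.  Both generating functions equal
--   q^η ∏_i [ s_i − 1 over k_{τ_i} − 1 ]_q,
-- where η is the sum of k_b over the pairs b > a with b before a in τ.
-- For Z this holds for every τ: removing the last letter a turns the class of τ
-- into the classes of the permutations obtained by moving a to the left (or, if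
-- k_a = 1, deleting it), and these add up by the q-Pascal and q-trinomial
-- identities.  For INV the last
-- letter of a consecutive τ is extreme, so its other copies are shuffled freely
-- and contribute a q-binomial coefficient.
-- Coefficients are compared by evaluating at a natural number q exceeding all
-- of them and reading off base-q digits.
module Submission where

open import Defs
open import Data.Bool using (Bool; true; false; T; if_then_else_; not; _∧_; _∨_; _xor_)
import Data.Bool.Properties as Bool
open import Data.Bool.Properties using (T?; ∧-assoc; ∧-comm; ∧-zeroʳ; ∨-assoc; ∨-identityʳ; xor-same)
open import Data.Bool.ListAction using (any; all)
open import Data.Fin using (Fin; toℕ)
import Data.Fin.Properties as Fin
open import Data.List using (List; []; _∷_; _++_; _∷ʳ_; length; map; filterᵇ; concatMap; allFin; upTo; take; drop; reverse; head)
open import Data.List.Properties hiding (sum-++)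
open import Data.List.Membership.Propositional using (_∈_; _∉_; find; lose)
open import Data.List.Membership.Propositional.Properties
open import Data.List.Membership.Propositional.Properties.WithK using (unique∧set⇒bag)
open import Data.List.Relation.Binary.BagAndSetEquality using (∼bag⇒↭)
open import Data.List.Relation.Binary.Permutation.Propositional using (_↭_; ↭-refl; ↭-sym; ↭-trans; prep; swap; ↭⇒↭ₛ)
open import Data.List.Relation.Binary.Permutation.Propositional.Properties using (map⁺; ↭-length; shift; filter-↭; ∈-resp-↭; ++⁺ˡ; ↭-reverse)
open import Data.List.Relation.Binary.Permutation.Setoid.Properties using (AllPairs-resp-↭)
open import Data.List.Relation.Unary.All as All using (All; []; _∷_)
open import Data.List.Relation.Unary.All.Properties using (All¬⇒¬Any; ¬Any⇒All¬)
open import Data.List.Relation.Unary.AllPairs using ([]; _∷_)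
open import Data.List.Relation.Unary.Any using (here; there)
open import Data.List.Relation.Unary.Unique.Propositional using (Unique)
import Data.List.Relation.Unary.Unique.Propositional.Properties as Unique
open import Data.Maybe using (Maybe; just; nothing)
open import Data.Nat
open import Data.Nat.Properties
open import Data.Nat.DivMod using ([m+kn]%n≡m%n; m<n⇒m%n≡m)
open import Data.Nat.ListAction using (sum)
open import Data.Nat.ListAction.Properties using (sum-++; sum-↭)
open import Data.Nat.Tactic.RingSolver using (solve-∀)
open import Data.Product using (_×_; _,_; proj₁; proj₂; ∃)
open import Data.Sum using (_⊎_; inj₁; inj₂)
open import Data.Unit using (⊤)
open import Function using (_∘_; id; mk⇔)
open import Relation.Binary.Definitions using (tri<; tri≈; tri>)
open import Relation.Binary.PropositionalEquality
open import Relation.Nullary using (Dec; yes; no)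
open import Relation.Nullary.Decidable using (dec-true; dec-false)
open import Relation.Nullary.Negation using (contradiction)
open ≡-Reasoning

-- Duplicate-free lists

-- Moving one copy of the last letter to the left can destroy consecutiveness, so the recursion used
-- for Z cannot be run inside the consecutive permutations. Nor can INV follow it outside them: for
-- the multiset 1, 2, 2, 3 and τ = 132, INV gives q + 2q² while Z gives q + q² + q³. INV needs a
-- recursion that keeps τ consecutive, and deleting all copies of the last letter at once does so,
-- since it only shortens τ. The same class is therefore enumerated twice, by `words` for Z and by
-- `shuffleWords` for INV. Both are duplicate-free lists with the elements of the class, hence
-- permutations of each other.
--
-- The two recursions meet in the product formula. For INV its exponent comes from the inversions of
-- the last letter; for Z it results from gains that differ from one insertion to the next and only
-- balance after summation.
--
-- Everything stays in the natural numbers: identities that would involve differences are stated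
-- with the missing term added to both sides, and q-factorial quotients with denominators cleared.

-- Pigeonhole: each head of `xs` is cut out of `ys`, distinctness keeps the other elements inside
-- what remains, and the length bound leaves nothing over.
unique-⊆-↭ : {A : Set} {xs ys : List A} → Unique xs →
  (∀ {x} → x ∈ xs → x ∈ ys) → length ys ≤ length xs → xs ↭ ys
unique-⊆-↭ {xs = []} {[]} _ _ _ = ↭-refl
unique-⊆-↭ {xs = x ∷ xs} (x# ∷ u) incl le
  with as , bs , refl ← ∈-∃++ (incl (here refl)) =
  ↭-trans (prep x (unique-⊆-↭ u incl′ le′)) (↭-sym (shift x as bs))
  where
  incl′ : ∀ {y} → y ∈ xs → y ∈ as ++ bs
  incl′ y∈ with ∈-++⁻ as (incl (there y∈))
  ... | inj₁ p = ∈-++⁺ˡ p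
  ... | inj₂ (here refl) = contradiction refl (All.lookup x# y∈)
  ... | inj₂ (there p) = ∈-++⁺ʳ as p
  le′ : length (as ++ bs) ≤ length xs
  le′ = s≤s⁻¹ (subst (_≤ suc (length xs)) (↭-length (shift x as bs)) le)

-- An injection of a finite set into itself is onto; thus no inverse of the Foata-Kadell map has to
-- be constructed.
injective-self-map-↭ : {A : Set} {xs : List A} (f : A → A) → Unique xs →
  (∀ {x y} → f x ≡ f y → x ≡ y) → (∀ {x} → x ∈ xs → f x ∈ xs) → map f xs ↭ xs
injective-self-map-↭ {xs = xs} f u inj closed =
  unique-⊆-↭ (Unique.map⁺ inj u) closed′ (≤-reflexive (sym (length-map f xs)))
  where
  closed′ : ∀ {y} → y ∈ map f xs → y ∈ xs
  closed′ y∈ with x , x∈ , refl ← ∈-map⁻ f y∈ = closed x∈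

unique-set-↭ : {A : Set} {xs ys : List A} → Unique xs → Unique ys →
  (∀ {x} → x ∈ xs → x ∈ ys) → (∀ {x} → x ∈ ys → x ∈ xs) → xs ↭ ys
unique-set-↭ u v to from = ∼bag⇒↭ (unique∧set⇒bag u v (mk⇔ to from))

unique-concatMap : {A B : Set} (f : A → List B) {xs : List A} → Unique xs →
  (∀ {x} → x ∈ xs → Unique (f x)) →
  (∀ {x y z} → x ∈ xs → y ∈ xs → z ∈ f x → z ∈ f y → x ≡ y) →
  Unique (concatMap f xs)
unique-concatMap f [] _ _ = []
unique-concatMap f {x ∷ xs} (x# ∷ u) uf inj =
  Unique.++⁺ (uf (here refl))
    (unique-concatMap f u (uf ∘ there) (λ p q → inj (there p) (there q)))
    λ { (z∈ , z∈′) → let y , y∈ , z∈fy = find (∈-concatMap⁻ f z∈′) in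
        All.lookup x# y∈ (inj (here refl) (there y∈) z∈ z∈fy) }

-- Sums of powers determine multiplicities

ind : Bool → ℕ
ind b = if b then 1 else 0

countᵇ-∷ : {A : Set} (p : A → Bool) (x : A) (xs : List A) →
  countᵇ p (x ∷ xs) ≡ ind (p x) + countᵇ p xs
countᵇ-∷ p x xs with p x
... | true  = refl
... | false = refl

countᵇ-map : {A B : Set} (p : B → Bool) (f : A → B) (xs : List A) →
  countᵇ p (map f xs) ≡ countᵇ (p ∘ f) xs
countᵇ-map p f [] = refl
countᵇ-map p f (x ∷ xs) = begin
  countᵇ p (f x ∷ map f xs)           ≡⟨ countᵇ-∷ p (f x) (map f xs) ⟩
  ind (p (f x)) + countᵇ p (map f xs) ≡⟨ cong (ind (p (f x)) +_) (countᵇ-map p f xs) ⟩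
  ind (p (f x)) + countᵇ (p ∘ f) xs   ≡⟨ countᵇ-∷ (p ∘ f) x xs ⟨
  countᵇ (p ∘ f) (x ∷ xs)             ∎

countᵇ-↭ : {A : Set} (p : A → Bool) {xs ys : List A} → xs ↭ ys → countᵇ p xs ≡ countᵇ p ys
countᵇ-↭ p σ = ↭-length (filter-↭ (T? ∘ p) σ)

occ : ℕ → List ℕ → ℕ
occ e = countᵇ (_≡ᵇ e)

powerSum : ℕ → List ℕ → ℕ
powerSum q xs = sum (map (q ^_) xs)

-- On power sums this is removal of the constant term followed by division by q, that is, the shift
-- by one base-q digit.
lowered : List ℕ → List ℕ
lowered []           = []
lowered (zero  ∷ xs) = lowered xs
lowered (suc x ∷ xs) = x ∷ lowered xs

powerSum-lowered : ∀ q xs → powerSum q xs ≡ occ 0 xs + powerSum q (lowered xs) * q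
powerSum-lowered q [] = refl
powerSum-lowered q (zero ∷ xs) = cong suc (powerSum-lowered q xs)
powerSum-lowered q (suc x ∷ xs) = begin
  q * q ^ x + powerSum q xs
    ≡⟨ cong (q * q ^ x +_) (powerSum-lowered q xs) ⟩
  q * q ^ x + (occ 0 xs + powerSum q (lowered xs) * q)
    ≡⟨ lem q (q ^ x) (occ 0 xs) (powerSum q (lowered xs)) ⟩
  occ 0 xs + (q ^ x + powerSum q (lowered xs)) * q ∎
  where
  lem : ∀ q a b c → q * a + (b + c * q) ≡ b + (a + c) * q
  lem = solve-∀

occ-lowered : ∀ e xs → occ (suc e) xs ≡ occ e (lowered xs)
occ-lowered e [] = refl
occ-lowered e (zero ∷ xs) = occ-lowered e xs
occ-lowered e (suc x ∷ xs) = begin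
  occ (suc e) (suc x ∷ xs)           ≡⟨ countᵇ-∷ (_≡ᵇ suc e) (suc x) xs ⟩
  ind (x ≡ᵇ e) + occ (suc e) xs      ≡⟨ cong (ind (x ≡ᵇ e) +_) (occ-lowered e xs) ⟩
  ind (x ≡ᵇ e) + occ e (lowered xs)  ≡⟨ countᵇ-∷ (_≡ᵇ e) x (lowered xs) ⟨
  occ e (x ∷ lowered xs)             ∎

length-lowered : ∀ xs → length (lowered xs) ≤ length xs
length-lowered [] = z≤n
length-lowered (zero ∷ xs) = m≤n⇒m≤1+n (length-lowered xs)
length-lowered (suc x ∷ xs) = s≤s (length-lowered xs)

occ≤length : ∀ e xs → occ e xs ≤ length xs
occ≤length e xs = length-filter (T? ∘ (_≡ᵇ e)) xs

divMod-unique : ∀ q {a b c d} → a < q → b < q → a + c * q ≡ b + d * q → a ≡ b × c ≡ d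
divMod-unique q@(suc _) {a} {b} {c} {d} a<q b<q eq =
  a≡b , *-cancelʳ-≡ c d q (+-cancelˡ-≡ b _ _ (trans (cong (_+ c * q) (sym a≡b)) eq))
  where
  a≡b : a ≡ b
  a≡b = begin
    a               ≡⟨ m<n⇒m%n≡m a<q ⟨
    a % q           ≡⟨ [m+kn]%n≡m%n a c q ⟨
    (a + c * q) % q ≡⟨ cong (_% q) eq ⟩
    (b + d * q) % q ≡⟨ [m+kn]%n≡m%n b d q ⟩
    b % q           ≡⟨ m<n⇒m%n≡m b<q ⟩
    b               ∎

-- Read in base q > |xs|, |ys|, the digits of the power sums are the multiplicities.
powerSum-injective : ∀ q xs ys → length xs < q → length ys < q →
  powerSum q xs ≡ powerSum q ys → ∀ e → occ e xs ≡ occ e ys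
powerSum-injective q xs ys xs<q ys<q eq = λ
  { zero → proj₁ digits
  ; (suc e) → trans (occ-lowered e xs) (trans
      (powerSum-injective q (lowered xs) (lowered ys)
        (≤-<-trans (length-lowered xs) xs<q) (≤-<-trans (length-lowered ys) ys<q)
        (proj₂ digits) e)
      (sym (occ-lowered e ys))) }
  where
  digits : occ 0 xs ≡ occ 0 ys × powerSum q (lowered xs) ≡ powerSum q (lowered ys)
  digits = divMod-unique q (≤-<-trans (occ≤length 0 xs) xs<q) (≤-<-trans (occ≤length 0 ys) ys<q)
    (trans (sym (powerSum-lowered q xs)) (trans eq (powerSum-lowered q ys)))

-- q-binomial coefficients

module QBinomial (q : ℕ) where

  ⟦_⟧ : ℕ → ℕ
  ⟦ zero  ⟧ = 0
  ⟦ suc n ⟧ = 1 + q * ⟦ n ⟧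

  ⟦⟧-+ : ∀ a b → ⟦ a + b ⟧ ≡ ⟦ a ⟧ + q ^ a * ⟦ b ⟧
  ⟦⟧-+ zero b = sym (+-identityʳ ⟦ b ⟧)
  ⟦⟧-+ (suc a) b = begin
    1 + q * ⟦ a + b ⟧                    ≡⟨ cong (λ z → 1 + q * z) (⟦⟧-+ a b) ⟩
    1 + q * (⟦ a ⟧ + q ^ a * ⟦ b ⟧)      ≡⟨ lem q ⟦ a ⟧ (q ^ a) ⟦ b ⟧ ⟩
    1 + q * ⟦ a ⟧ + q * q ^ a * ⟦ b ⟧    ∎
    where
    lem : ∀ q a p b → 1 + q * (a + p * b) ≡ 1 + q * a + q * p * b
    lem = solve-∀

  fact : ℕ → ℕ
  fact zero    = 1
  fact (suc n) = ⟦ suc n ⟧ * fact n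

  fact-nonZero : ∀ n → NonZero (fact n)
  fact-nonZero zero = _
  fact-nonZero (suc n) = m*n≢0 ⟦ suc n ⟧ (fact n) {{_}} {{fact-nonZero n}}

  -- binom a b is the q-binomial coefficient of a + b over a.
  binom : ℕ → ℕ → ℕ
  binom zero    b       = 1
  binom (suc a) zero    = 1
  binom (suc a) (suc b) = binom a (suc b) + q ^ suc a * binom (suc a) b

  -- The factorial formula with cleared denominators. Since every ⟦n + 1⟧ is positive, factorials
  -- can be cancelled, and the symmetry and trinomial identities below follow from it.
  binom-fact : ∀ a b → binom a b * (fact a * fact b) ≡ fact (a + b)
  binom-fact zero b = trans (+-identityʳ _) (+-identityʳ _)
  binom-fact (suc a) zero = begin
    1 * (fact (suc a) * 1) ≡⟨ trans (+-identityʳ _) (*-identityʳ _) ⟩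
    fact (suc a)           ≡⟨ cong fact (sym (+-identityʳ (suc a))) ⟩
    fact (suc a + 0)       ∎
  binom-fact (suc a) (suc b) = begin
    (binom a (suc b) + p * binom (suc a) b) * (x * fact a * (y * fact b))
      ≡⟨ lem₁ (binom a (suc b)) p (binom (suc a) b) x (fact a) y (fact b) ⟩
    x * (binom a (suc b) * (fact a * (y * fact b))) + p * y * (binom (suc a) b * (x * fact a * fact b))
      ≡⟨ cong₂ (λ u v → x * u + p * y * v) (binom-fact a (suc b)) (binom-fact (suc a) b) ⟩
    x * fact (a + suc b) + p * y * fact (suc (a + b))
      ≡⟨ cong (λ z → x * fact z + p * y * fact (suc (a + b))) (+-suc a b) ⟩
    x * fact (suc (a + b)) + p * y * fact (suc (a + b))
      ≡⟨ *-distribʳ-+ (fact (suc (a + b))) x (p * y) ⟨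
    (x + p * y) * fact (suc (a + b))
      ≡⟨ cong (_* fact (suc (a + b))) (⟦⟧-+ (suc a) (suc b)) ⟨
    ⟦ suc a + suc b ⟧ * fact (suc (a + b))
      ≡⟨ cong (λ z → ⟦ suc a + suc b ⟧ * fact z) (+-suc a b) ⟨
    fact (suc a + suc b) ∎
    where
    x = ⟦ suc a ⟧
    y = ⟦ suc b ⟧
    p = q ^ suc a
    lem₁ : ∀ B p C x f y g →
      (B + p * C) * (x * f * (y * g)) ≡ x * (B * (f * (y * g))) + p * y * (C * (x * f * g))
    lem₁ = solve-∀

  binom-sym : ∀ a b → binom a b ≡ binom b a
  binom-sym a b = *-cancelʳ-≡ _ _ (fact a * fact b)
    {{m*n≢0 (fact a) (fact b) {{fact-nonZero a}} {{fact-nonZero b}}}} (begin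
    binom a b * (fact a * fact b) ≡⟨ binom-fact a b ⟩
    fact (a + b)                  ≡⟨ cong fact (+-comm a b) ⟩
    fact (b + a)                  ≡⟨ binom-fact b a ⟨
    binom b a * (fact b * fact a) ≡⟨ cong (binom b a *_) (*-comm (fact b) (fact a)) ⟩
    binom b a * (fact a * fact b) ∎)

  binom-pascalʳ : ∀ a b →
    binom (suc a) (suc b) ≡ q ^ suc b * binom a (suc b) + binom (suc a) b
  binom-pascalʳ a b = begin
    binom (suc a) (suc b)                            ≡⟨ binom-sym (suc a) (suc b) ⟩
    binom b (suc a) + q ^ suc b * binom (suc b) a    ≡⟨ +-comm (binom b (suc a)) _ ⟩
    q ^ suc b * binom (suc b) a + binom b (suc a)
      ≡⟨ cong₂ (λ u v → q ^ suc b * u + v) (binom-sym (suc b) a) (binom-sym b (suc a)) ⟩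
    q ^ suc b * binom a (suc b) + binom (suc a) b    ∎

  -- Both sides are the q-multinomial coefficient with parts a, b, c, in which either a or b is
  -- chosen before the other.
  binom-trinomial : ∀ a b c → binom a (b + c) * binom b c ≡ binom b (a + c) * binom a c
  binom-trinomial a b c = *-cancelʳ-≡ _ _ (fact a * (fact b * fact c))
    {{m*n≢0 _ _ {{fact-nonZero a}} {{m*n≢0 _ _ {{fact-nonZero b}} {{fact-nonZero c}}}}}} (begin
    binom a (b + c) * binom b c * (fact a * (fact b * fact c))
      ≡⟨ half a b c ⟩
    fact (a + (b + c))
      ≡⟨ cong fact (trans (sym (+-assoc a b c)) (trans (cong (_+ c) (+-comm a b)) (+-assoc b a c))) ⟩
    fact (b + (a + c))
      ≡⟨ half b a c ⟨
    binom b (a + c) * binom a c * (fact b * (fact a * fact c))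
      ≡⟨ cong (binom b (a + c) * binom a c *_) (lem (fact a) (fact b) (fact c)) ⟩
    binom b (a + c) * binom a c * (fact a * (fact b * fact c)) ∎)
    where
    lem : ∀ x y z → y * (x * z) ≡ x * (y * z)
    lem = solve-∀
    lem₂ : ∀ u v x y → u * v * (x * y) ≡ u * (x * (v * y))
    lem₂ = solve-∀
    half : ∀ a b c → binom a (b + c) * binom b c * (fact a * (fact b * fact c)) ≡ fact (a + (b + c))
    half a b c = begin
      binom a (b + c) * binom b c * (fact a * (fact b * fact c))
        ≡⟨ lem₂ (binom a (b + c)) (binom b c) (fact a) (fact b * fact c) ⟩
      binom a (b + c) * (fact a * (binom b c * (fact b * fact c)))
        ≡⟨ cong (λ z → binom a (b + c) * (fact a * z)) (binom-fact b c) ⟩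
      binom a (b + c) * (fact a * fact (b + c))
        ≡⟨ binom-fact a (b + c) ⟩
      fact (a + (b + c)) ∎

-- The statistics read from the right end of the word

<ᵇ-true : ∀ {a b} → a < b → (a <ᵇ b) ≡ true
<ᵇ-true {a} {b} a<b = dec-true (a <? b) a<b

<ᵇ-false : ∀ {a b} → b ≤ a → (a <ᵇ b) ≡ false
<ᵇ-false {a} {b} b≤a = dec-false (a <? b) (≤⇒≯ b≤a)

≡ᵇ-false : ∀ {a b} → a ≢ b → (a ≡ᵇ b) ≡ false
≡ᵇ-false {a} {b} a≢b = dec-false (a ≟ b) a≢b

≡ᵇ-refl : ∀ a → (a ≡ᵇ a) ≡ true
≡ᵇ-refl a = dec-true (a ≟ a) refl

-- Peeled at the largest index, because a letter prepended to a reversed word receives the largest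
-- position.
Σ≤ : ℕ → (ℕ → ℕ) → ℕ
Σ≤ zero    f = 0
Σ≤ (suc n) f = Σ≤ n f + f (suc n)

Σ≤-cong : ∀ n {f g} → (∀ i → i ≤ n → f i ≡ g i) → Σ≤ n f ≡ Σ≤ n g
Σ≤-cong zero _ = refl
Σ≤-cong (suc n) eq = cong₂ _+_ (Σ≤-cong n (λ i i≤n → eq i (m≤n⇒m≤1+n i≤n))) (eq (suc n) ≤-refl)

Σ≤-zero : ∀ n {f} → (∀ i → i ≤ n → f i ≡ 0) → Σ≤ n f ≡ 0
Σ≤-zero zero _ = refl
Σ≤-zero (suc n) eq =
  cong₂ _+_ (Σ≤-zero n (λ i i≤n → eq i (m≤n⇒m≤1+n i≤n))) (eq (suc n) ≤-refl)

Σ≤-+ : ∀ n f g → Σ≤ n (λ i → f i + g i) ≡ Σ≤ n f + Σ≤ n g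
Σ≤-+ zero f g = refl
Σ≤-+ (suc n) f g = trans (cong (_+ (f (suc n) + g (suc n))) (Σ≤-+ n f g))
  (lem (Σ≤ n f) (Σ≤ n g) (f (suc n)) (g (suc n)))
  where
  lem : ∀ a b c d → a + b + (c + d) ≡ a + c + (b + d)
  lem = solve-∀

sum-pos : ∀ n f → sum (map f (pos n)) ≡ Σ≤ n f
sum-pos zero f = refl
sum-pos (suc n) f = begin
  sum (map f (map suc (upTo (suc n))))
    ≡⟨ cong (sum ∘ map f ∘ map suc) (upTo-∷ʳ n) ⟨
  sum (map f (map suc (upTo n ∷ʳ n)))
    ≡⟨ cong (sum ∘ map f) (map-++ suc (upTo n) (n ∷ [])) ⟩
  sum (map f (pos n ∷ʳ suc n))
    ≡⟨ cong sum (map-++ f (pos n) (suc n ∷ [])) ⟩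
  sum (map f (pos n) ∷ʳ f (suc n))
    ≡⟨ sum-++ (map f (pos n)) _ ⟩
  sum (map f (pos n)) + (f (suc n) + 0)
    ≡⟨ cong₂ _+_ (sum-pos n f) (+-identityʳ _) ⟩
  Σ≤ n f + f (suc n) ∎

countᵇ-sum : {A : Set} (p : A → Bool) (xs : List A) → countᵇ p xs ≡ sum (map (ind ∘ p) xs)
countᵇ-sum p [] = refl
countᵇ-sum p (x ∷ xs) = trans (countᵇ-∷ p x xs) (cong (ind (p x) +_) (countᵇ-sum p xs))

countᵇ-++ : {A : Set} (p : A → Bool) (xs ys : List A) →
  countᵇ p (xs ++ ys) ≡ countᵇ p xs + countᵇ p ys
countᵇ-++ p xs ys = trans (cong length (filter-++ (T? ∘ p) xs ys)) (length-++ (filterᵇ p xs))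

countᵇ-pairs : ∀ (p : ℕ × ℕ → Bool) n →
  countᵇ p (pairs n) ≡ Σ≤ n (λ i → Σ≤ n (λ j → ind (p (i , j))))
countᵇ-pairs p n = trans (go (pos n)) (sum-pos n _)
  where
  go : ∀ is → countᵇ p (concatMap (λ i → map (i ,_) (pos n)) is) ≡
       sum (map (λ i → Σ≤ n (λ j → ind (p (i , j)))) is)
  go [] = refl
  go (i ∷ is) = trans (countᵇ-++ p (map (i ,_) (pos n)) _) (cong₂ _+_
    (begin
      countᵇ p (map (i ,_) (pos n))              ≡⟨ countᵇ-map p (i ,_) (pos n) ⟩
      countᵇ (p ∘ (i ,_)) (pos n)                ≡⟨ countᵇ-sum (p ∘ (i ,_)) (pos n) ⟩
      sum (map (λ j → ind (p (i , j))) (pos n))  ≡⟨ sum-pos n _ ⟩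
      Σ≤ n (λ j → ind (p (i , j)))               ∎)
    (go is))

_≻_ : ∀ {m} → Maybe (Fin m) → Maybe (Fin m) → Bool
just a  ≻ just b  = toℕ b <ᵇ toℕ a
just _  ≻ nothing = false
nothing ≻ _       = false

≻-nothing : ∀ {m} (y : Maybe (Fin m)) → (y ≻ nothing) ≡ false
≻-nothing (just _) = refl
≻-nothing nothing  = refl

gtAt-≻ : ∀ {m} (w : Word m) i j → gtAt w i j ≡ (at w i ≻ at w j)
gtAt-≻ w i j with at w i | at w j
... | just _  | just _  = refl
... | just _  | nothing = refl
... | nothing | just _  = refl
... | nothing | nothing = refl

at-∷ʳ-≤ : ∀ {m} (w : Word m) x i → i ≤ length w → at (w ∷ʳ x) i ≡ at w i
at-∷ʳ-≤ []      x zero          _ = refl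
at-∷ʳ-≤ (y ∷ w) x zero          _ = refl
at-∷ʳ-≤ (y ∷ w) x (suc zero)    _ = refl
at-∷ʳ-≤ (y ∷ w) x (suc (suc i)) (s≤s le) = at-∷ʳ-≤ w x (suc i) le

at-∷ʳ-last : ∀ {m} (w : Word m) x → at (w ∷ʳ x) (suc (length w)) ≡ just x
at-∷ʳ-last [] x = refl
at-∷ʳ-last (y ∷ w) x = at-∷ʳ-last w x

at-> : ∀ {m} (w : Word m) i → length w < i → at w i ≡ nothing
at-> []      i             _ = refl
at-> (y ∷ w) (suc (suc i)) (s≤s lt) = at-> w (suc i) lt

-- In a reversed word, positions are still counted from the far end.
atʳ : ∀ {m} → Word m → ℕ → Maybe (Fin m)
atʳ r = at (reverse r)

atʳ-≤ : ∀ {m} x (r : Word m) i → i ≤ length r → atʳ (x ∷ r) i ≡ atʳ r i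
atʳ-≤ x r i le = trans (cong (λ w → at w i) (unfold-reverse x r))
  (at-∷ʳ-≤ (reverse r) x i (subst (i ≤_) (sym (length-reverse r)) le))

atʳ-top : ∀ {m} x (r : Word m) → atʳ (x ∷ r) (suc (length r)) ≡ just x
atʳ-top x r = begin
  at (reverse (x ∷ r)) (suc (length r))
    ≡⟨ cong₂ (λ w n → at w (suc n)) (unfold-reverse x r) (sym (length-reverse r)) ⟩
  at (reverse r ∷ʳ x) (suc (length (reverse r)))
    ≡⟨ at-∷ʳ-last (reverse r) x ⟩
  just x ∎

atʳ-> : ∀ {m} (r : Word m) i → length r < i → atʳ r i ≡ nothing
atʳ-> r i lt = at-> (reverse r) i (subst (_< i) (sym (length-reverse r)) lt)

-- Recursive forms of INV and MAJ_d

above : ∀ {m} → Fin m → Word m → ℕ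
above x = countᵇ (λ z → toℕ x <ᵇ toℕ z)

inv : ∀ {m} → Word m → ℕ
inv []      = 0
inv (x ∷ r) = above x r + inv r

-- The value `suc (length r)` is the position of `y` counted from the left end of the original word,
-- which is what a descent contributes to MAJ.
descent : ∀ {m} → Fin m → Word m → ℕ
descent x []      = 0
descent x (y ∷ r) = if toℕ x <ᵇ toℕ y then suc (length r) else 0

-- majd c corresponds to MAJ with parameter d = c + 1.
majd : ∀ {m} → ℕ → Word m → ℕ
majd c []      = 0
majd c (x ∷ r) = above x (take c r) + descent x (drop c r) + majd c r

pairCount : ∀ {m} → (ℕ → ℕ → Bool) → Word m → ℕ
pairCount P r = Σ≤ n (λ i → Σ≤ n (λ j → ind (P i j ∧ (atʳ r i ≻ atʳ r j))))
  where n = length r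

-- The new letter sits at the largest position and adds one row and one column to the table of
-- pairs; the row vanishes because `P` is false for j ≤ i.
pairCount-∷ : ∀ {m} (P : ℕ → ℕ → Bool) → (∀ {i j} → j ≤ i → P i j ≡ false) →
  ∀ x (r : Word m) → pairCount P (x ∷ r) ≡
  pairCount P r + Σ≤ (length r) (λ i → ind (P i (suc (length r)) ∧ (atʳ r i ≻ just x)))
pairCount-∷ P P-false x r = begin
  Σ≤ n (λ i → Σ≤ n (g′ i) + g′ i (suc n)) + Σ≤ (suc n) (g′ (suc n))
    ≡⟨ cong₂ _+_ (Σ≤-cong n (λ i i≤n → cong₂ _+_ (Σ≤-cong n (old i i≤n)) (new i i≤n)))
                 (Σ≤-zero (suc n) (λ j j≤n → cong (λ b → ind (b ∧ (atʳ (x ∷ r) (suc n) ≻ atʳ (x ∷ r) j)))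
                    (P-false j≤n))) ⟩
  Σ≤ n (λ i → Σ≤ n (g i) + h i) + 0
    ≡⟨ +-identityʳ _ ⟩
  Σ≤ n (λ i → Σ≤ n (g i) + h i)
    ≡⟨ Σ≤-+ n (λ i → Σ≤ n (g i)) h ⟩
  Σ≤ n (λ i → Σ≤ n (g i)) + Σ≤ n h ∎
  where
  n = length r
  g g′ : ℕ → ℕ → ℕ
  g  i j = ind (P i j ∧ (atʳ r i ≻ atʳ r j))
  g′ i j = ind (P i j ∧ (atʳ (x ∷ r) i ≻ atʳ (x ∷ r) j))
  h : ℕ → ℕ
  h i = ind (P i (suc n) ∧ (atʳ r i ≻ just x))
  old : ∀ i → i ≤ n → ∀ j → j ≤ n → g′ i j ≡ g i j
  old i i≤n j j≤n = cong₂ (λ u v → ind (P i j ∧ (u ≻ v))) (atʳ-≤ x r i i≤n) (atʳ-≤ x r j j≤n)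
  new : ∀ i → i ≤ n → g′ i (suc n) ≡ h i
  new i i≤n = cong₂ (λ u v → ind (P i (suc n) ∧ (u ≻ v))) (atʳ-≤ x r i i≤n) (atʳ-top x r)

Σ-above : ∀ {m} (x : Fin m) r → Σ≤ (length r) (λ i → ind (atʳ r i ≻ just x)) ≡ above x r
Σ-above x [] = refl
Σ-above x (y ∷ r) = begin
  Σ≤ (length r) (λ i → ind (atʳ (y ∷ r) i ≻ just x)) + ind (atʳ (y ∷ r) (suc (length r)) ≻ just x)
    ≡⟨ cong₂ _+_ (Σ≤-cong (length r) (λ i le → cong (λ u → ind (u ≻ just x)) (atʳ-≤ y r i le)))
                 (cong (λ u → ind (u ≻ just x)) (atʳ-top y r)) ⟩
  Σ≤ (length r) (λ i → ind (atʳ r i ≻ just x)) + ind (toℕ x <ᵇ toℕ y)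
    ≡⟨ cong (_+ ind (toℕ x <ᵇ toℕ y)) (Σ-above x r) ⟩
  above x r + ind (toℕ x <ᵇ toℕ y)
    ≡⟨ +-comm (above x r) _ ⟩
  ind (toℕ x <ᵇ toℕ y) + above x r
    ≡⟨ countᵇ-∷ (λ z → toℕ x <ᵇ toℕ z) y r ⟨
  above x (y ∷ r) ∎

-- The inequality selects the `c` largest positions of `r`, and these hold the first `c` letters of
-- the reversed word.
Σ-above-take : ∀ {m} c (x : Fin m) r →
  Σ≤ (length r) (λ i → ind ((suc (length r) <ᵇ i + suc c) ∧ (atʳ r i ≻ just x))) ≡ above x (take c r)
Σ-above-take zero x r = Σ≤-zero (length r) (λ i le →
  cong (λ b → ind (b ∧ (atʳ r i ≻ just x))) (<ᵇ-false (subst (_≤ suc (length r)) (+-comm 1 i) (s≤s le))))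
Σ-above-take (suc c) x [] = refl
Σ-above-take (suc c) x (y ∷ r) = begin
  Σ≤ n (f (y ∷ r)) + f (y ∷ r) (suc n)
    ≡⟨ cong₂ _+_ (Σ≤-cong n old) new ⟩
  Σ≤ n (λ i → ind ((suc n <ᵇ i + suc c) ∧ (atʳ r i ≻ just x))) + ind (toℕ x <ᵇ toℕ y)
    ≡⟨ cong (_+ ind (toℕ x <ᵇ toℕ y)) (Σ-above-take c x r) ⟩
  above x (take c r) + ind (toℕ x <ᵇ toℕ y)
    ≡⟨ +-comm (above x (take c r)) _ ⟩
  ind (toℕ x <ᵇ toℕ y) + above x (take c r)
    ≡⟨ countᵇ-∷ (λ z → toℕ x <ᵇ toℕ z) y (take c r) ⟨
  above x (take (suc c) (y ∷ r)) ∎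
  where
  n = length r
  f : Word _ → ℕ → ℕ
  f s i = ind ((suc (suc n) <ᵇ i + suc (suc c)) ∧ (atʳ s i ≻ just x))
  old : ∀ i → i ≤ n → f (y ∷ r) i ≡ ind ((suc n <ᵇ i + suc c) ∧ (atʳ r i ≻ just x))
  old i le = cong₂ (λ k u → ind ((suc (suc n) <ᵇ k) ∧ (u ≻ just x))) (+-suc i (suc c)) (atʳ-≤ y r i le)
  new : f (y ∷ r) (suc n) ≡ ind (toℕ x <ᵇ toℕ y)
  new = cong₂ (λ b u → ind (b ∧ (u ≻ just x)))
    (<ᵇ-true (subst (suc (suc n) <_) (sym (+-suc (suc n) (suc c))) (s≤s (s≤s (subst (suc n ≤_) (sym (+-suc n c)) (s≤s (m≤m+n n c)))))))
    (atʳ-top y r)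

-- Only i = length r - c can satisfy the equation, and that is the position of the first letter of
-- `drop c r`.
Σ-descent : ∀ {m} c (x : Fin m) r →
  Σ≤ (length r) (λ i → if (i + suc c ≡ᵇ suc (length r)) ∧ (atʳ r i ≻ just x) then i else 0) ≡
  descent x (drop c r)
Σ-descent zero x [] = refl
Σ-descent zero x (y ∷ r) = cong₂ _+_
  (Σ≤-zero n (λ i le → cong (λ b → if b ∧ (atʳ (y ∷ r) i ≻ just x) then i else 0)
    (≡ᵇ-false (λ eq → <-irrefl (suc-injective (trans (+-comm 1 i) eq)) (s≤s le)))))
  (cong₂ (λ b u → if b ∧ (u ≻ just x) then suc n else 0)
    (trans (cong (_≡ᵇ suc n) (+-comm n 1)) (≡ᵇ-refl n))
    (atʳ-top y r))
  where n = length r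
Σ-descent (suc c) x [] = refl
Σ-descent (suc c) x (y ∷ r) = begin
  Σ≤ n f + f (suc n)
    ≡⟨ cong₂ _+_ (Σ≤-cong n old) new ⟩
  Σ≤ n (λ i → if (i + suc c ≡ᵇ suc n) ∧ (atʳ r i ≻ just x) then i else 0) + 0
    ≡⟨ +-identityʳ _ ⟩
  Σ≤ n (λ i → if (i + suc c ≡ᵇ suc n) ∧ (atʳ r i ≻ just x) then i else 0)
    ≡⟨ Σ-descent c x r ⟩
  descent x (drop c r) ∎
  where
  n = length r
  f : ℕ → ℕ
  f i = if (i + suc (suc c) ≡ᵇ suc (suc n)) ∧ (atʳ (y ∷ r) i ≻ just x) then i else 0
  old : ∀ i → i ≤ n → f i ≡ (if (i + suc c ≡ᵇ suc n) ∧ (atʳ r i ≻ just x) then i else 0)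
  old i le = cong₂ (λ k u → if (k ≡ᵇ suc (suc n)) ∧ (u ≻ just x) then i else 0)
    (+-suc i (suc c)) (atʳ-≤ y r i le)
  new : f (suc n) ≡ 0
  new = cong (λ b → if b ∧ (atʳ (y ∷ r) (suc n) ≻ just x) then suc n else 0)
    (≡ᵇ-false (λ eq → m≢1+m+n (suc n) (sym (trans (sym (+-suc (suc n) c)) (suc-injective (trans (sym (+-suc (suc n) (suc c))) eq))))))

distantDescents : ∀ {m} → ℕ → Word m → ℕ
distantDescents d r = Σ≤ (length r) (λ i → if atʳ r i ≻ atʳ r (i + d) then i else 0)

distantDescents-∷ : ∀ {m} c x (r : Word m) →
  distantDescents (suc c) (x ∷ r) ≡ distantDescents (suc c) r + descent x (drop c r)
distantDescents-∷ c x r = begin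
  Σ≤ n f + f (suc n)
    ≡⟨ cong₂ _+_ (Σ≤-cong n split) top ⟩
  Σ≤ n (λ i → g i + h i) + 0
    ≡⟨ +-identityʳ _ ⟩
  Σ≤ n (λ i → g i + h i)
    ≡⟨ Σ≤-+ n g h ⟩
  Σ≤ n g + Σ≤ n h
    ≡⟨ cong (Σ≤ n g +_) (Σ-descent c x r) ⟩
  Σ≤ n g + descent x (drop c r) ∎
  where
  n = length r
  f g h : ℕ → ℕ
  f i = if atʳ (x ∷ r) i ≻ atʳ (x ∷ r) (i + suc c) then i else 0
  g i = if atʳ r i ≻ atʳ r (i + suc c) then i else 0
  h i = if (i + suc c ≡ᵇ suc n) ∧ (atʳ r i ≻ just x) then i else 0
  zero-if : ∀ i (u : Maybe (Fin _)) {v} → v ≡ nothing → (if u ≻ v then i else 0) ≡ 0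
  zero-if i u refl = cong (if_then i else 0) (≻-nothing u)
  top : f (suc n) ≡ 0
  top = zero-if (suc n) (atʳ (x ∷ r) (suc n)) (atʳ-> (x ∷ r) (suc n + suc c) (m<m+n (suc n) (s≤s z≤n)))
  split : ∀ i → i ≤ n → f i ≡ g i + h i
  -- Beyond the end of a word `at` yields `nothing`, which compares as no descent; hence the index
  -- with i + suc c = suc n is the only one at which the longer word differs from `r`.
  split i i≤n with <-cmp (i + suc c) (suc n)
  ... | tri< lt ne _ = begin
    f i       ≡⟨ cong₂ (λ u v → if u ≻ v then i else 0) (atʳ-≤ x r i i≤n) (atʳ-≤ x r (i + suc c) (s≤s⁻¹ lt)) ⟩
    g i       ≡⟨ +-identityʳ (g i) ⟨
    g i + 0   ≡⟨ cong (λ b → g i + (if b ∧ (atʳ r i ≻ just x) then i else 0)) (≡ᵇ-false ne) ⟨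
    g i + h i ∎
  ... | tri≈ _ eq _ = begin
    f i
      ≡⟨ cong₂ (λ u v → if u ≻ v then i else 0) (atʳ-≤ x r i i≤n) (trans (cong (atʳ (x ∷ r)) eq) (atʳ-top x r)) ⟩
    (if atʳ r i ≻ just x then i else 0)
      ≡⟨ cong (λ b → if b ∧ (atʳ r i ≻ just x) then i else 0) (trans (cong (_≡ᵇ suc n) eq) (≡ᵇ-refl n)) ⟨
    h i
      ≡⟨ cong (_+ h i) (zero-if i (atʳ r i) (atʳ-> r (i + suc c) (≤-reflexive (sym eq)))) ⟨
    g i + h i ∎
  ... | tri> _ ne gt = begin
    f i
      ≡⟨ zero-if i (atʳ (x ∷ r) i) (atʳ-> (x ∷ r) (i + suc c) gt) ⟩
    0
      ≡⟨ cong₂ _+_ (zero-if i (atʳ r i) (atʳ-> r (i + suc c) (<-trans (n<1+n n) gt)))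
                   (cong (λ b → if b ∧ (atʳ r i ≻ just x) then i else 0) (≡ᵇ-false ne)) ⟨
    g i + h i ∎

INV-reverse : ∀ {m} (r : Word m) → INV (reverse r) ≡ inv r
INV-reverse r = trans (trans (countᵇ-pairs _ (length (reverse r))) unfolded) (go r)
  where
  n = length r
  P : ℕ → ℕ → Bool
  P = _<ᵇ_
  unfolded : Σ≤ (length (reverse r)) (λ i → Σ≤ (length (reverse r)) (λ j →
      ind ((i <ᵇ j) ∧ gtAt (reverse r) i j))) ≡ pairCount P r
  unfolded = trans (cong (λ k → Σ≤ k (λ i → Σ≤ k (λ j → ind ((i <ᵇ j) ∧ gtAt (reverse r) i j)))) (length-reverse r))
    (Σ≤-cong n (λ i _ → Σ≤-cong n (λ j _ → cong (λ b → ind ((i <ᵇ j) ∧ b)) (gtAt-≻ (reverse r) i j))))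
  go : ∀ r → pairCount P r ≡ inv r
  go [] = refl
  go (x ∷ r) = begin
    pairCount P (x ∷ r)
      ≡⟨ pairCount-∷ P <ᵇ-false x r ⟩
    pairCount P r + Σ≤ (length r) (λ i → ind ((i <ᵇ suc (length r)) ∧ (atʳ r i ≻ just x)))
      ≡⟨ cong₂ _+_ (go r) (trans
           (Σ≤-cong (length r) (λ i le → cong (λ b → ind (b ∧ (atʳ r i ≻ just x))) (<ᵇ-true (s≤s le))))
           (Σ-above x r)) ⟩
    inv r + above x r
      ≡⟨ +-comm (inv r) _ ⟩
    inv (x ∷ r) ∎

MAJd-reverse : ∀ {m} c (r : Word m) → MAJd (suc c) (reverse r) ≡ majd c r
MAJd-reverse c r = trans (cong₂ _+_ (trans (countᵇ-pairs _ (length (reverse r))) near)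
                                    (trans (sum-pos (length (reverse r)) _) far)) (go r)
  where
  n = length r
  P : ℕ → ℕ → Bool
  P i j = (i <ᵇ j) ∧ (j <ᵇ i + suc c)
  near : Σ≤ (length (reverse r)) (λ i → Σ≤ (length (reverse r)) (λ j →
      ind ((i <ᵇ j) ∧ (j <ᵇ i + suc c) ∧ gtAt (reverse r) i j))) ≡ pairCount P r
  near = trans (cong (λ k → Σ≤ k (λ i → Σ≤ k (λ j → ind ((i <ᵇ j) ∧ (j <ᵇ i + suc c) ∧ gtAt (reverse r) i j)))) (length-reverse r))
    (Σ≤-cong n (λ i _ → Σ≤-cong n (λ j _ → cong ind (trans
      (sym (∧-assoc (i <ᵇ j) (j <ᵇ i + suc c) _))
      (cong (P i j ∧_) (gtAt-≻ (reverse r) i j))))))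
  far : Σ≤ (length (reverse r)) (λ i → if gtAt (reverse r) i (i + suc c) then i else 0) ≡ distantDescents (suc c) r
  far = trans (cong (λ k → Σ≤ k (λ i → if gtAt (reverse r) i (i + suc c) then i else 0)) (length-reverse r))
    (Σ≤-cong n (λ i _ → cong (if_then i else 0) (gtAt-≻ (reverse r) i (i + suc c))))
  go : ∀ r → pairCount P r + distantDescents (suc c) r ≡ majd c r
  go [] = refl
  go (x ∷ r) = begin
    pairCount P (x ∷ r) + distantDescents (suc c) (x ∷ r)
      ≡⟨ cong₂ _+_ (pairCount-∷ P (λ {i} {j} le → cong (_∧ (j <ᵇ i + suc c)) (<ᵇ-false le)) x r)
                   (distantDescents-∷ c x r) ⟩
    pairCount P r + Σ≤ (length r) (λ i → ind (P i (suc (length r)) ∧ (atʳ r i ≻ just x)))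
      + (distantDescents (suc c) r + descent x (drop c r))
      ≡⟨ cong (λ z → pairCount P r + z + (distantDescents (suc c) r + descent x (drop c r))) (trans
           (Σ≤-cong (length r) (λ i le → cong (λ b → ind ((b ∧ (suc (length r) <ᵇ i + suc c)) ∧ (atʳ r i ≻ just x))) (<ᵇ-true (s≤s le))))
           (Σ-above-take c x r)) ⟩
    pairCount P r + above x (take c r) + (distantDescents (suc c) r + descent x (drop c r))
      ≡⟨ lem (pairCount P r) (above x (take c r)) _ _ ⟩
    above x (take c r) + descent x (drop c r) + (pairCount P r + distantDescents (suc c) r)
      ≡⟨ cong (above x (take c r) + descent x (drop c r) +_) (go r) ⟩
    majd c (x ∷ r) ∎
    where
    lem : ∀ a b c d → a + b + (c + d) ≡ b + d + (a + c)
    lem = solve-∀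

-- The window i < j < i + 1 is empty, so results on MAJ_d cover MAJ and also the two-letter subwords
-- in Z.
MAJ≡MAJd : ∀ {m} (w : Word m) → MAJ w ≡ MAJd 1 w
MAJ≡MAJd w = sym (cong₂ _+_
  (trans (countᵇ-pairs _ n) (Σ≤-zero n (λ i _ → Σ≤-zero n (λ j _ → cong ind (never i j (gtAt w i j))))))
  (cong sum (map-cong (λ i → cong (λ j → if gtAt w i j then i else 0) (+-comm i 1)) (pos n))))
  where
  n = length w
  never : ∀ i j b → ((i <ᵇ j) ∧ (j <ᵇ i + 1) ∧ b) ≡ false
  never i j b with i <? j
  ... | no i≮j = cong (_∧ ((j <ᵇ i + 1) ∧ b)) (<ᵇ-false (≮⇒≥ i≮j))
  ... | yes i<j = trans (cong ((i <ᵇ j) ∧_) (cong (_∧ b) (<ᵇ-false {j} {i + 1} (subst (_≤ j) (+-comm 1 i) i<j)))) (∧-zeroʳ (i <ᵇ j))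

-- The Foata–Kadell transformation

bool-cases : ∀ b → (b ≡ true) ⊎ (b ≡ false)
bool-cases true  = inj₁ refl
bool-cases false = inj₂ refl

bigger : ∀ {m} → Fin m → Fin m → Bool
bigger x z = toℕ x <ᵇ toℕ z

bigger-true : ∀ {m} {x y : Fin m} → bigger x y ≡ true → toℕ x < toℕ y
bigger-true {x = x} {y} eq = <ᵇ⇒< (toℕ x) (toℕ y) (subst T (sym eq) _)

bigger-false : ∀ {m} {x y : Fin m} → bigger x y ≡ false → toℕ y ≤ toℕ x
bigger-false {x = x} {y} eq = ≮⇒≥ (λ lt → subst T eq (<⇒<ᵇ lt))

above-true : ∀ {m} {x y : Fin m} r → toℕ x < toℕ y → above x (y ∷ r) ≡ suc (above x r)
above-true {x = x} {y} r lt = trans (countᵇ-∷ (bigger x) y r) (cong (λ b → ind b + above x r) (<ᵇ-true lt))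

above-false : ∀ {m} {x y : Fin m} r → toℕ y ≤ toℕ x → above x (y ∷ r) ≡ above x r
above-false {x = x} {y} r le = trans (countᵇ-∷ (bigger x) y r) (cong (λ b → ind b + above x r) (<ᵇ-false le))

filterᵇ-∷ : {A : Set} (p : A → Bool) (x : A) (xs : List A) →
  filterᵇ p (x ∷ xs) ≡ (if p x then x ∷ filterᵇ p xs else filterᵇ p xs)
filterᵇ-∷ p x xs with p x
... | true  = refl
... | false = refl

-- The carried letter y moves right past the letters of the other class
-- (p-value), and is dropped in exchange for the next letter of its own class.
-- On reversed words this is one step of Foata's cyclic shift of blocks.
pass : {A : Set} → (A → Bool) → A → List A → List A
pass p y []       = y ∷ []
pass p y (z ∷ zs) = if p y xor p z then z ∷ pass p y zs else y ∷ pass p z zs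

pass-↭ : {A : Set} (p : A → Bool) (y : A) (zs : List A) → pass p y zs ↭ y ∷ zs
pass-↭ p y [] = ↭-refl
pass-↭ p y (z ∷ zs) with p y xor p z
... | true  = ↭-trans (prep z (pass-↭ p y zs)) (swap z y ↭-refl)
... | false = prep y (pass-↭ p z zs)

-- The carried letter is only ever exchanged for one of its own class. The output therefore reveals
-- the class of the first input letter, which is the information needed to undo `pass`.
pass-last : {A : Set} (p : A → Bool) (y : A) (zs : List A) →
  ∃ λ us → ∃ λ e → pass p y zs ≡ us ∷ʳ e × p e ≡ p y
pass-last p y [] = [] , y , refl , refl
pass-last p y (z ∷ zs) with p y in py | p z in pz
... | true  | false with us , e , eq , pe ← pass-last p y zs = z ∷ us , e , cong (z ∷_) eq , trans pe py
... | false | true  with us , e , eq , pe ← pass-last p y zs = z ∷ us , e , cong (z ∷_) eq , trans pe py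
... | true  | true  with us , e , eq , pe ← pass-last p z zs = y ∷ us , e , cong (y ∷_) eq , trans pe pz
... | false | false with us , e , eq , pe ← pass-last p z zs = y ∷ us , e , cong (y ∷_) eq , trans pe pz

pass-same : {A : Set} (p : A → Bool) {y z : A} (zs : List A) → p y ≡ p z →
  pass p y (z ∷ zs) ≡ y ∷ pass p z zs
pass-same p {y} {z} zs eq =
  cong (if_then z ∷ pass p y zs else y ∷ pass p z zs) (trans (cong (_xor p z) eq) (xor-same (p z)))

pass-diff : {A : Set} (p : A → Bool) {y z : A} (zs : List A) → p y ≢ p z →
  pass p y (z ∷ zs) ≡ z ∷ pass p y zs
pass-diff p {y} {z} zs ne with p y | p z
... | true  | true  = contradiction refl ne
... | true  | false = refl
... | false | true  = refl
... | false | false = contradiction refl ne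

pass-injective : {A : Set} (p : A → Bool) {y y′ : A} (zs zs′ : List A) → p y ≡ p y′ →
  pass p y zs ≡ pass p y′ zs′ → y ∷ zs ≡ y′ ∷ zs′
pass-injective p {y} {y′} zs zs′ py eq = go zs zs′ py (suc-injective len) eq
  where
  len : suc (length zs) ≡ suc (length zs′)
  len = trans (sym (↭-length (pass-↭ p y zs))) (trans (cong length eq) (↭-length (pass-↭ p y′ zs′)))
  go : ∀ {y y′} zs zs′ → p y ≡ p y′ → length zs ≡ length zs′ →
    pass p y zs ≡ pass p y′ zs′ → y ∷ zs ≡ y′ ∷ zs′
  go [] [] py len eq = eq
  go {y} {y′} (z ∷ zs) (z′ ∷ zs′) py len eq with p y Bool.≟ p z | p y′ Bool.≟ p z′
  ... | yes a | yes b
    with e₁ , e₂ ← ∷-injective (trans (sym (pass-same p zs a)) (trans eq (pass-same p zs′ b))) =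
    cong₂ _∷_ e₁ (go zs zs′ (trans (sym a) (trans py b)) (suc-injective len) e₂)
  ... | no a | no b
    with e₁ , e₂ ← ∷-injective (trans (sym (pass-diff p zs a)) (trans eq (pass-diff p zs′ b)))
    with refl , refl ← ∷-injective (go zs zs′ py (suc-injective len) e₂) =
    cong (λ u → y ∷ u ∷ zs) e₁
  -- In the first case the output starts with a letter of the carried class, in the second with one
  -- of the other class, so the outputs differ; the next case is symmetric.
  ... | yes a | no b
    with e₁ , _ ← ∷-injective (trans (sym (pass-same p zs a)) (trans eq (pass-diff p zs′ b))) =
    contradiction (trans (sym py) (cong p e₁)) b
  ... | no a | yes b
    with e₁ , _ ← ∷-injective (trans (sym (pass-diff p zs a)) (trans eq (pass-same p zs′ b))) =
    contradiction (trans py (cong p (sym e₁))) a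

shiftBlocks : {A : Set} → (A → Bool) → List A → List A
shiftBlocks p []       = []
shiftBlocks p (y ∷ zs) = pass p y zs

shiftBlocks-↭ : {A : Set} (p : A → Bool) (u : List A) → shiftBlocks p u ↭ u
shiftBlocks-↭ p [] = ↭-refl
shiftBlocks-↭ p (y ∷ zs) = pass-↭ p y zs

shiftBlocks-injective : {A : Set} (p : A → Bool) (u v : List A) →
  shiftBlocks p u ≡ shiftBlocks p v → u ≡ v
shiftBlocks-injective p [] [] eq = refl
shiftBlocks-injective p [] (y ∷ zs) eq =
  contradiction (trans (cong length eq) (↭-length (pass-↭ p y zs))) λ ()
shiftBlocks-injective p (y ∷ zs) [] eq =
  contradiction (trans (cong length (sym eq)) (↭-length (pass-↭ p y zs))) λ ()
shiftBlocks-injective p (y ∷ zs) (y′ ∷ zs′) eq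
  with us , e , eq₁ , pe ← pass-last p y zs | us′ , e′ , eq₂ , pe′ ← pass-last p y′ zs′ =
  pass-injective p zs zs′
    (trans (sym pe) (trans (cong p (∷ʳ-injectiveʳ us us′ (trans (sym eq₁) (trans eq eq₂)))) pe′)) eq

-- `pass` only interchanges neighbours of different classes, and two such letters never both satisfy
-- `I`.
shiftBlocks-filter : {A : Set} (p I : A → Bool) →
  (∀ {y z} → I y ≡ true → I z ≡ true → p y ≡ p z) →
  ∀ u → filterᵇ I (shiftBlocks p u) ≡ filterᵇ I u
shiftBlocks-filter p I hom [] = refl
shiftBlocks-filter {A} p I hom (y ∷ zs) = go y zs
  where
  prepend : ∀ z {us vs : List A} → filterᵇ I us ≡ filterᵇ I vs → filterᵇ I (z ∷ us) ≡ filterᵇ I (z ∷ vs)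
  prepend z eq with I z
  ... | true  = cong (z ∷_) eq
  ... | false = eq
  exchange : ∀ y z zs → p y ≢ p z → filterᵇ I (z ∷ y ∷ zs) ≡ filterᵇ I (y ∷ z ∷ zs)
  exchange y z zs ne with I y in iy | I z in iz
  ... | true  | true  = contradiction (hom iy iz) ne
  ... | true  | false rewrite iy | iz = refl
  ... | false | true  rewrite iz | iy = refl
  ... | false | false rewrite iz | iy = refl
  go : ∀ y zs → filterᵇ I (pass p y zs) ≡ filterᵇ I (y ∷ zs)
  go y [] = refl
  go y (z ∷ zs) with p y Bool.≟ p z
  ... | yes eq = trans (cong (filterᵇ I) (pass-same p zs eq)) (prepend y (go z zs))
  ... | no ne  = trans (cong (filterᵇ I) (pass-diff p zs ne))
    (trans (prepend z (go y zs)) (exchange y z zs ne))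

-- The carried letter stays larger than `x` throughout and passes each letter ≤ x of `zs` exactly
-- once. In the original word it moves to the left of that smaller letter, which creates one
-- inversion.
inv-pass-big : ∀ {m} (x y : Fin m) zs → bigger x y ≡ true →
  inv (pass (bigger x) y zs) ≡ countᵇ (not ∘ bigger x) zs + inv (y ∷ zs)
inv-pass-big x y [] _ = refl
inv-pass-big x y (z ∷ zs) y-big with bool-cases (bigger x z)
... | inj₁ eq = begin
  inv (pass (bigger x) y (z ∷ zs))
    ≡⟨ cong inv (pass-same (bigger x) zs (trans y-big (sym eq))) ⟩
  above y (pass (bigger x) z zs) + inv (pass (bigger x) z zs)
    ≡⟨ cong₂ _+_ (countᵇ-↭ (bigger y) (pass-↭ (bigger x) z zs)) (inv-pass-big x z zs eq) ⟩
  above y (z ∷ zs) + (small zs + inv (z ∷ zs))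
    ≡⟨ lem (above y (z ∷ zs)) (small zs) (inv (z ∷ zs)) ⟩
  small zs + (above y (z ∷ zs) + inv (z ∷ zs))
    ≡⟨ cong (λ b → ind (not b) + small zs + inv (y ∷ z ∷ zs)) eq ⟨
  ind (not (bigger x z)) + small zs + inv (y ∷ z ∷ zs)
    ≡⟨ cong (_+ inv (y ∷ z ∷ zs)) (countᵇ-∷ (not ∘ bigger x) z zs) ⟨
  small (z ∷ zs) + inv (y ∷ z ∷ zs) ∎
  where
  small = countᵇ (not ∘ bigger x)
  lem : ∀ a b c → a + (b + c) ≡ b + (a + c)
  lem = solve-∀
... | inj₂ eq = begin
  inv (pass (bigger x) y (z ∷ zs))
    ≡⟨ cong inv (pass-diff (bigger x) zs (λ e → contradiction (trans (sym y-big) (trans e eq)) λ ())) ⟩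
  above z (pass (bigger x) y zs) + inv (pass (bigger x) y zs)
    ≡⟨ cong₂ _+_ (countᵇ-↭ (bigger z) (pass-↭ (bigger x) y zs)) (inv-pass-big x y zs y-big) ⟩
  above z (y ∷ zs) + (small zs + inv (y ∷ zs))
    ≡⟨ cong (_+ (small zs + inv (y ∷ zs))) (above-true zs z<y) ⟩
  suc (above z zs) + (small zs + (above y zs + inv zs))
    ≡⟨ lem (above z zs) (small zs) (above y zs) (inv zs) ⟩
  suc (small zs) + (above y zs + (above z zs + inv zs))
    ≡⟨ cong (λ k → suc (small zs) + (k + (above z zs + inv zs))) (above-false zs (<⇒≤ z<y)) ⟨
  suc (small zs) + inv (y ∷ z ∷ zs)
    ≡⟨ cong (λ b → ind (not b) + small zs + inv (y ∷ z ∷ zs)) eq ⟨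
  ind (not (bigger x z)) + small zs + inv (y ∷ z ∷ zs)
    ≡⟨ cong (_+ inv (y ∷ z ∷ zs)) (countᵇ-∷ (not ∘ bigger x) z zs) ⟨
  small (z ∷ zs) + inv (y ∷ z ∷ zs) ∎
  where
  small = countᵇ (not ∘ bigger x)
  z<y : toℕ z < toℕ y
  z<y = ≤-<-trans (bigger-false {x = x} {z} eq) (bigger-true {x = x} {y} y-big)
  lem : ∀ a b c d → suc a + (b + (c + d)) ≡ suc b + (c + (a + d))
  lem = solve-∀

-- Dually, the carried letter is at most `x` and its passage across each letter > x of `zs` destroys
-- one inversion.
inv-pass-small : ∀ {m} (x y : Fin m) zs → bigger x y ≡ false →
  above x zs + inv (pass (bigger x) y zs) ≡ inv (y ∷ zs)
inv-pass-small x y [] _ = refl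
inv-pass-small x y (z ∷ zs) y-small with bool-cases (bigger x z)
... | inj₂ eq = begin
  above x (z ∷ zs) + inv (pass (bigger x) y (z ∷ zs))
    ≡⟨ cong₂ _+_ (above-false zs (bigger-false {x = x} {z} eq))
                 (cong inv (pass-same (bigger x) zs (trans y-small (sym eq)))) ⟩
  above x zs + (above y (pass (bigger x) z zs) + inv (pass (bigger x) z zs))
    ≡⟨ lem (above x zs) (above y (pass (bigger x) z zs)) (inv (pass (bigger x) z zs)) ⟩
  above y (pass (bigger x) z zs) + (above x zs + inv (pass (bigger x) z zs))
    ≡⟨ cong₂ _+_ (countᵇ-↭ (bigger y) (pass-↭ (bigger x) z zs)) (inv-pass-small x z zs eq) ⟩
  inv (y ∷ z ∷ zs) ∎
  where
  lem : ∀ a b c → a + (b + c) ≡ b + (a + c)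
  lem = solve-∀
... | inj₁ eq = begin
  above x (z ∷ zs) + inv (pass (bigger x) y (z ∷ zs))
    ≡⟨ cong₂ _+_ (above-true zs (bigger-true {x = x} {z} eq))
                 (cong inv (pass-diff (bigger x) zs (λ e → contradiction (trans (sym y-small) (trans e eq)) λ ()))) ⟩
  suc (above x zs) + (above z (pass (bigger x) y zs) + inv (pass (bigger x) y zs))
    ≡⟨ lem₁ (above x zs) (above z (pass (bigger x) y zs)) (inv (pass (bigger x) y zs)) ⟩
  suc (above z (pass (bigger x) y zs)) + (above x zs + inv (pass (bigger x) y zs))
    ≡⟨ cong₂ (λ a b → suc a + b)
         (trans (countᵇ-↭ (bigger z) (pass-↭ (bigger x) y zs)) (above-false zs (<⇒≤ y<z)))
         (inv-pass-small x y zs y-small) ⟩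
  suc (above z zs) + (above y zs + inv zs)
    ≡⟨ lem₁ (above z zs) (above y zs) (inv zs) ⟩
  suc (above y zs) + (above z zs + inv zs)
    ≡⟨ cong (_+ (above z zs + inv zs)) (above-true zs y<z) ⟨
  inv (y ∷ z ∷ zs) ∎
  where
  y<z : toℕ y < toℕ z
  y<z = ≤-<-trans (bigger-false {x = x} {y} y-small) (bigger-true {x = x} {z} eq)
  lem₁ : ∀ a b c → suc a + (b + c) ≡ suc b + (a + c)
  lem₁ = solve-∀

countᵇ-not : {A : Set} (p : A → Bool) (xs : List A) →
  countᵇ p xs + countᵇ (not ∘ p) xs ≡ length xs
countᵇ-not p [] = refl
countᵇ-not p (x ∷ xs) with p x
... | true  = cong suc (countᵇ-not p xs)
... | false = trans (+-suc _ _) (cong suc (countᵇ-not p xs))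

-- The reason for Foata's shift. If `u` starts with a letter > x, the inversions made by `x` count
-- the larger letters and the shift adds the number of the others, together the length of `u`, which
-- is the descent position. Otherwise the shift destroys exactly as many inversions as `x` makes.
inv-shiftBlocks : ∀ {m} (x : Fin m) u →
  above x u + inv (shiftBlocks (bigger x) u) ≡ descent x u + inv u
inv-shiftBlocks x [] = refl
inv-shiftBlocks x (y ∷ zs) with bool-cases (bigger x y)
... | inj₁ eq = begin
  above x (y ∷ zs) + inv (pass (bigger x) y zs)
    ≡⟨ cong₂ _+_ (above-true zs (bigger-true {x = x} {y} eq)) (inv-pass-big x y zs eq) ⟩
  suc (above x zs) + (countᵇ (not ∘ bigger x) zs + inv (y ∷ zs))
    ≡⟨ +-assoc (suc (above x zs)) _ _ ⟨
  suc (above x zs + countᵇ (not ∘ bigger x) zs) + inv (y ∷ zs)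
    ≡⟨ cong (λ k → suc k + inv (y ∷ zs)) (countᵇ-not (bigger x) zs) ⟩
  suc (length zs) + inv (y ∷ zs)
    ≡⟨ cong (λ b → (if b then suc (length zs) else 0) + inv (y ∷ zs)) eq ⟨
  descent x (y ∷ zs) + inv (y ∷ zs) ∎
... | inj₂ eq = trans (cong (_+ inv (pass (bigger x) y zs)) (above-false zs (bigger-false {x = x} {y} eq)))
  (trans (inv-pass-small x y zs eq)
    (cong (λ b → (if b then suc (length zs) else 0) + inv (y ∷ zs)) (sym eq)))

-- Inversions between `s` and the tail depend only on the multiset of the tail, so rearranging it
-- changes `inv` by the same amount with and without `s`.
inv-++-↭ : ∀ {m} (s : Word m) {u v} → u ↭ v → inv (s ++ v) + inv u ≡ inv (s ++ u) + inv v
inv-++-↭ [] {u} {v} σ = +-comm (inv v) (inv u)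
inv-++-↭ (x ∷ s) {u} {v} σ = begin
  above x (s ++ v) + inv (s ++ v) + inv u
    ≡⟨ +-assoc (above x (s ++ v)) _ _ ⟩
  above x (s ++ v) + (inv (s ++ v) + inv u)
    ≡⟨ cong₂ _+_ (countᵇ-↭ (bigger x) (++⁺ˡ s (↭-sym σ))) (inv-++-↭ s σ) ⟩
  above x (s ++ u) + (inv (s ++ u) + inv v)
    ≡⟨ +-assoc (above x (s ++ u)) _ _ ⟨
  above x (s ++ u) + inv (s ++ u) + inv v ∎

-- The `c` letters nearest to `x` stay in place because MAJ_d with d = c + 1 already counts their
-- inversions with `x`; only the part that contributes through a descent is shifted.
foata : ∀ {m} → ℕ → Word m → Word m
foata c []      = []
foata c (x ∷ r) = x ∷ take c (foata c r) ++ shiftBlocks (bigger x) (drop c (foata c r))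

take-++-shiftBlocks-↭ : {A : Set} (p : A → Bool) → ∀ c (a : List A) →
  take c a ++ shiftBlocks p (drop c a) ↭ a
take-++-shiftBlocks-↭ p c a = subst (take c a ++ shiftBlocks p (drop c a) ↭_) (take++drop≡id c a)
  (++⁺ˡ (take c a) (shiftBlocks-↭ p (drop c a)))

foata-↭ : ∀ {m} c (r : Word m) → foata c r ↭ r
foata-↭ c [] = ↭-refl
foata-↭ c (x ∷ r) = prep x (↭-trans (take-++-shiftBlocks-↭ (bigger x) c (foata c r)) (foata-↭ c r))

take-suc⇒take : {A : Set} → ∀ c {a b : List A} → take (suc c) a ≡ take (suc c) b → take c a ≡ take c b
take-suc⇒take zero eq = refl
take-suc⇒take (suc c) {[]} {[]} eq = refl
take-suc⇒take (suc c) {x ∷ a} {y ∷ b} eq with refl , eq′ ← ∷-injective eq =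
  cong (x ∷_) (take-suc⇒take c eq′)

take-++-shiftBlocks : {A : Set} (p : A → Bool) → ∀ c (a : List A) →
  take c (take c a ++ shiftBlocks p (drop c a)) ≡ take c a
take-++-shiftBlocks p zero a = refl
take-++-shiftBlocks p (suc c) [] = refl
take-++-shiftBlocks p (suc c) (x ∷ a) = cong (x ∷_) (take-++-shiftBlocks p c a)

-- `x` and the `c` letters after it are never shifted. The bound `suc c` is the one needed next: `c`
-- letters for the counted inversions and one more for the letter that decides the descent.
take-foata : ∀ {m} c (r : Word m) → take (suc c) (foata c r) ≡ take (suc c) r
take-foata c [] = refl
take-foata c (x ∷ r) = cong (x ∷_) (trans (take-++-shiftBlocks (bigger x) c (foata c r))
  (take-suc⇒take c (take-foata c r)))

descent-cong : ∀ {m} (x : Fin m) c a b → take (suc c) a ≡ take (suc c) b → length a ≡ length b →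
  descent x (drop c a) ≡ descent x (drop c b)
descent-cong x c [] [] eq len = refl
descent-cong x zero (y ∷ a) (z ∷ b) eq len with refl ← ∷-injectiveˡ eq =
  cong (λ n → if bigger x y then n else 0) len
descent-cong x (suc c) (y ∷ a) (z ∷ b) eq len =
  descent-cong x c a b (∷-injectiveʳ eq) (suc-injective len)

inv-foata : ∀ {m} c (r : Word m) → inv (foata c r) ≡ majd c r
inv-foata c [] = refl
-- Adding `inv u` on both sides lets `u` be replaced by its shift `v` behind `s` without
-- subtraction.
inv-foata c (x ∷ r) = +-cancelʳ-≡ (inv u) _ _ (begin
  above x (s ++ v) + inv (s ++ v) + inv u
    ≡⟨ +-assoc (above x (s ++ v)) _ _ ⟩
  above x (s ++ v) + (inv (s ++ v) + inv u)
    ≡⟨ cong₂ _+_ (countᵇ-++ (bigger x) s v) (inv-++-↭ s (↭-sym (shiftBlocks-↭ (bigger x) u))) ⟩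
  above x s + above x v + (inv (s ++ u) + inv v)
    ≡⟨ cong₂ (λ k l → above x s + k + (inv l + inv v))
         (countᵇ-↭ (bigger x) (shiftBlocks-↭ (bigger x) u)) (take++drop≡id c (foata c r)) ⟩
  above x s + above x u + (inv (foata c r) + inv v)
    ≡⟨ lem₁ (above x s) (above x u) _ _ ⟩
  above x s + (above x u + inv v) + inv (foata c r)
    ≡⟨ cong₂ (λ k l → above x s + k + l) (inv-shiftBlocks x u) (inv-foata c r) ⟩
  above x s + (descent x u + inv u) + majd c r
    ≡⟨ lem₂ (above x s) (descent x u) _ _ ⟩
  above x s + descent x u + majd c r + inv u
    ≡⟨ cong₂ (λ k l → k + l + majd c r + inv u)
         (cong (above x) (take-suc⇒take c (take-foata c r)))
         (descent-cong x c (foata c r) r (take-foata c r) (↭-length (foata-↭ c r))) ⟩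
  majd c (x ∷ r) + inv u ∎)
  where
  s = take c (foata c r)
  u = drop c (foata c r)
  v = shiftBlocks (bigger x) u
  lem₁ : ∀ a b c d → a + b + (c + d) ≡ a + (b + d) + c
  lem₁ = solve-∀
  lem₂ : ∀ a b c d → a + (b + c) + d ≡ a + b + d + c
  lem₂ = solve-∀

take-++-shiftBlocks-injective : {A : Set} (p : A → Bool) → ∀ c (a b : List A) → length a ≡ length b →
  take c a ++ shiftBlocks p (drop c a) ≡ take c b ++ shiftBlocks p (drop c b) → a ≡ b
take-++-shiftBlocks-injective p zero a b len eq = shiftBlocks-injective p a b eq
take-++-shiftBlocks-injective p (suc c) [] [] len eq = refl
take-++-shiftBlocks-injective p (suc c) (x ∷ a) (y ∷ b) len eq with refl , eq′ ← ∷-injective eq =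
  cong (x ∷_) (take-++-shiftBlocks-injective p c a b (suc-injective len) eq′)

foata-injective : ∀ {m} c {r s : Word m} → foata c r ≡ foata c s → r ≡ s
foata-injective c {[]} {[]} eq = refl
foata-injective c {x ∷ r} {y ∷ s} eq with refl , eq′ ← ∷-injective eq =
  cong (x ∷_) (foata-injective c (take-++-shiftBlocks-injective (bigger x) c (foata c r) (foata c s) len eq′))
  where
  same = take-++-shiftBlocks-↭ (bigger x) c
  len : length (foata c r) ≡ length (foata c s)
  len = trans (sym (↭-length (same (foata c r)))) (trans (cong length eq′) (↭-length (same (foata c s))))

-- Intervals of letters under the Foata-Kadell map

Convex : ∀ {m} → (Fin m → Bool) → Set
Convex {m} I = ∀ {a b c : Fin m} → I a ≡ true → I c ≡ true →
  toℕ a ≤ toℕ b → toℕ b ≤ toℕ c → I b ≡ true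

-- If two letters of the interval lay on different sides of `x`, convexity would put `x` into it.
convex-homogeneous : ∀ {m} (I : Fin m → Bool) (x : Fin m) → Convex I → I x ≡ false →
  ∀ {y z} → I y ≡ true → I z ≡ true → bigger x y ≡ bigger x z
convex-homogeneous I x conv x∉I {y} {z} y∈I z∈I with bigger x y in ey | bigger x z in ez
... | true  | true  = refl
... | false | false = refl
... | true  | false = contradiction
  (trans (sym x∉I) (conv z∈I y∈I (bigger-false {x = x} {z} ez) (<⇒≤ (bigger-true {x = x} {y} ey)))) λ ()
... | false | true  = contradiction
  (trans (sym x∉I) (conv y∈I z∈I (bigger-false {x = x} {y} ey) (<⇒≤ (bigger-true {x = x} {z} ez)))) λ ()

-- An `x` in `I` becomes the head on both sides; an `x` outside leaves the whole subword in `I`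
-- untouched. No more than the head survives in general, since an `x` inside `I` may separate the
-- letters of `I`.
foata-head : ∀ {m} c (I : Fin m → Bool) → Convex I → ∀ r →
  head (filterᵇ I (foata c r)) ≡ head (filterᵇ I r)
foata-head c I conv [] = refl
foata-head c I conv (x ∷ r) with I x in x∈I
... | true  = refl
... | false = begin
  head (filterᵇ I (s ++ shiftBlocks (bigger x) u))
    ≡⟨ cong head (filter-++ (T? ∘ I) s _) ⟩
  head (filterᵇ I s ++ filterᵇ I (shiftBlocks (bigger x) u))
    ≡⟨ cong (λ k → head (filterᵇ I s ++ k)) (shiftBlocks-filter (bigger x) I (convex-homogeneous I x conv x∈I) u) ⟩
  head (filterᵇ I s ++ filterᵇ I u)
    ≡⟨ cong head (filter-++ (T? ∘ I) s u) ⟨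
  head (filterᵇ I (s ++ u))
    ≡⟨ cong (head ∘ filterᵇ I) (take++drop≡id c (foata c r)) ⟩
  head (filterᵇ I (foata c r))
    ≡⟨ foata-head c I conv r ⟩
  head (filterᵇ I r) ∎
  where
  s = take c (foata c r)
  u = drop c (foata c r)

-- Orders of first occurrences

eqL⇒≡ : ∀ {m} {a b : Fin m} → eqL a b ≡ true → a ≡ b
eqL⇒≡ {a = a} {b} eq = Fin.toℕ-injective (≡ᵇ⇒≡ (toℕ a) (toℕ b) (subst T (sym eq) _))

eqL-refl : ∀ {m} (a : Fin m) → eqL a a ≡ true
eqL-refl a = ≡ᵇ-refl (toℕ a)

eqL-false : ∀ {m} {a b : Fin m} → a ≢ b → eqL a b ≡ false
eqL-false ne = ≡ᵇ-false (ne ∘ Fin.toℕ-injective)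

filterᵇ-cong : {A : Set} {p p′ : A → Bool} → (∀ z → p z ≡ p′ z) → ∀ xs → filterᵇ p xs ≡ filterᵇ p′ xs
filterᵇ-cong eq [] = refl
filterᵇ-cong {p = p} {p′} eq (x ∷ xs) with p x | p′ x | eq x
... | true  | .true  | refl = cong (x ∷_) (filterᵇ-cong eq xs)
... | false | .false | refl = filterᵇ-cong eq xs

filterᵇ-filterᵇ : {A : Set} (p p′ : A → Bool) → ∀ xs →
  filterᵇ p (filterᵇ p′ xs) ≡ filterᵇ (λ z → p′ z ∧ p z) xs
filterᵇ-filterᵇ p p′ [] = refl
filterᵇ-filterᵇ p p′ (x ∷ xs) with p′ x
... | false = filterᵇ-filterᵇ p p′ xs
... | true with p x
...   | true  = cong (x ∷_) (filterᵇ-filterᵇ p p′ xs)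
...   | false = filterᵇ-filterᵇ p p′ xs

filterᵇ-comm : {A : Set} (p p′ : A → Bool) → ∀ xs →
  filterᵇ p (filterᵇ p′ xs) ≡ filterᵇ p′ (filterᵇ p xs)
filterᵇ-comm p p′ xs = trans (filterᵇ-filterᵇ p p′ xs) (trans
  (filterᵇ-cong (λ z → ∧-comm (p′ z) (p z)) xs) (sym (filterᵇ-filterᵇ p′ p xs)))

filterᵇ-true : {A : Set} (p : A → Bool) {x : A} → p x ≡ true → ∀ xs → filterᵇ p (x ∷ xs) ≡ x ∷ filterᵇ p xs
filterᵇ-true p {x} eq xs = trans (filterᵇ-∷ p x xs) (cong (if_then x ∷ filterᵇ p xs else filterᵇ p xs) eq)

filterᵇ-false : {A : Set} (p : A → Bool) {x : A} → p x ≡ false → ∀ xs → filterᵇ p (x ∷ xs) ≡ filterᵇ p xs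
filterᵇ-false p {x} eq xs = trans (filterᵇ-∷ p x xs) (cong (if_then x ∷ filterᵇ p xs else filterᵇ p xs) eq)

filterᵇ-map : {A B : Set} (p : B → Bool) (f : A → B) → ∀ xs →
  map f (filterᵇ (p ∘ f) xs) ≡ filterᵇ p (map f xs)
filterᵇ-map p f [] = refl
filterᵇ-map p f (x ∷ xs) with p (f x)
... | true  = cong (f x ∷_) (filterᵇ-map p f xs)
... | false = filterᵇ-map p f xs

filterᵇ-id : {A : Set} (p : A → Bool) → ∀ xs → (∀ {z} → z ∈ xs → p z ≡ true) → filterᵇ p xs ≡ xs
filterᵇ-id p xs all = filter-all (T? ∘ p) (All.tabulate (λ z∈ → subst T (sym (all z∈)) _))

∈-filterᵇ⁻ : {A : Set} (p : A → Bool) → ∀ {z} {xs : List A} → z ∈ filterᵇ p xs → z ∈ xs × p z ≡ true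
∈-filterᵇ⁻ p {z} z∈ with z∈xs , pz ← ∈-filter⁻ (T? ∘ p) z∈ = z∈xs , T⇒true pz
  where
  T⇒true : ∀ {b} → T b → b ≡ true
  T⇒true {true} _ = refl

∈-filterᵇ⁺ : {A : Set} (p : A → Bool) → ∀ {z} {xs : List A} → z ∈ xs → p z ≡ true → z ∈ filterᵇ p xs
∈-filterᵇ⁺ p z∈ pz = ∈-filter⁺ (T? ∘ p) z∈ (subst T (sym pz) _)

without : ∀ {m} → Fin m → Word m → Word m
without a = filterᵇ (λ z → not (eqL a z))

∉-without : ∀ {m} (a : Fin m) r → a ∉ without a r
∉-without a r a∈ = contradiction
  (trans (sym (proj₂ (∈-filterᵇ⁻ (λ z → not (eqL a z)) {xs = r} a∈))) (cong not (eqL-refl a))) λ ()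

without-∉ : ∀ {m} {a : Fin m} {r} → a ∉ r → without a r ≡ r
without-∉ {a = a} {r} a∉ = filterᵇ-id _ r (λ {z} z∈ → cong not (eqL-false {a = a} {z} (λ { refl → a∉ z∈ })))

order : ∀ {m} → Word m → Word m
order []      = []
order (x ∷ r) = x ∷ without x (order r)

order-filter : ∀ {m} (p : Fin m → Bool) r → order (filterᵇ p r) ≡ filterᵇ p (order r)
order-filter p [] = refl
order-filter p (x ∷ r) with bool-cases (p x)
... | inj₁ px = begin
  order (filterᵇ p (x ∷ r))                ≡⟨ cong order (filterᵇ-true p px r) ⟩
  x ∷ without x (order (filterᵇ p r))      ≡⟨ cong (λ s → x ∷ without x s) (order-filter p r) ⟩
  x ∷ without x (filterᵇ p (order r))      ≡⟨ cong (x ∷_) (filterᵇ-comm _ p (order r)) ⟩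
  x ∷ filterᵇ p (without x (order r))      ≡⟨ filterᵇ-true p px _ ⟨
  filterᵇ p (order (x ∷ r))                ∎
... | inj₂ px = begin
  order (filterᵇ p (x ∷ r))                ≡⟨ cong order (filterᵇ-false p px r) ⟩
  order (filterᵇ p r)                      ≡⟨ order-filter p r ⟩
  filterᵇ p (order r)                      ≡⟨ filterᵇ-cong absorb (order r) ⟨
  filterᵇ (λ z → not (eqL x z) ∧ p z) (order r) ≡⟨ filterᵇ-filterᵇ p _ (order r) ⟨
  filterᵇ p (without x (order r))          ≡⟨ filterᵇ-false p px _ ⟨
  filterᵇ p (order (x ∷ r))                ∎
  where
  absorb : ∀ z → (not (eqL x z) ∧ p z) ≡ p z
  absorb z with bool-cases (eqL x z)
  ... | inj₁ e = trans (cong (λ b → not b ∧ p z) e) (sym (trans (cong p (sym (eqL⇒≡ e))) px))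
  ... | inj₂ e = cong (λ b → not b ∧ p z) e

head-order : ∀ {m} (r : Word m) → head (order r) ≡ head r
head-order []      = refl
head-order (x ∷ r) = refl

order-unique : ∀ {m} (r : Word m) → Unique (order r)
order-unique [] = []
order-unique (x ∷ r) = ¬Any⇒All¬ _ (∉-without x (order r)) ∷ Unique.filter⁺ _ (order-unique r)

member : ∀ {m} → Word m → Fin m → Bool
member β z = any (eqL z) β

member-true : ∀ {m} {β : Word m} {z} → z ∈ β → member β z ≡ true
member-true {β = z ∷ β} (here refl) = cong (_∨ member β z) (eqL-refl z)
member-true {β = b ∷ β} {z} (there z∈) = trans (cong (eqL z b ∨_) (member-true z∈)) (Bool.∨-zeroʳ (eqL z b))

member⇒∈ : ∀ {m} (β : Word m) {z} → member β z ≡ true → z ∈ β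
member⇒∈ (b ∷ β) {z} eq with bool-cases (eqL z b)
... | inj₁ e = here (eqL⇒≡ e)
... | inj₂ e = there (member⇒∈ β (trans (cong (_∨ member β z) (sym e)) eq))

member-false : ∀ {m} {β : Word m} {z} → z ∉ β → member β z ≡ false
member-false {β = β} {z} z∉ with bool-cases (member β z)
... | inj₁ e = contradiction (member⇒∈ β e) z∉
... | inj₂ e = e

-- Consecutive, for the reversed tail permutation.
ConvexTails : ∀ {m} → Word m → Set
ConvexTails []      = ⊤
ConvexTails (a ∷ β) = Convex (member (a ∷ β)) × ConvexTails β

without-member : ∀ {m} {a : Fin m} {β} → a ∉ β → ∀ r →
  without a (filterᵇ (member (a ∷ β)) r) ≡ filterᵇ (member β) r
without-member {a = a} {β} a∉β r = trans (filterᵇ-filterᵇ _ (member (a ∷ β)) r) (filterᵇ-cong same r)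
  where
  same : ∀ z → (member (a ∷ β) z ∧ not (eqL a z)) ≡ member β z
  same z with a Fin.≟ z
  ... | yes refl = trans (cong (λ b → member (a ∷ β) a ∧ not b) (eqL-refl a))
    (trans (Bool.∧-zeroʳ _) (sym (member-false a∉β)))
  ... | no ne = trans (cong₂ (λ b c → (b ∨ member β z) ∧ not c) (eqL-false (ne ∘ sym)) (eqL-false ne))
    (Bool.∧-identityʳ _)

filter-order-≡ : ∀ {m} {a : Fin m} {β} → a ∉ β → ∀ r →
  order (filterᵇ (member (a ∷ β)) r) ≡ a ∷ β → order (filterᵇ (member β) r) ≡ β
filter-order-≡ {a = a} {β} a∉β r eq = begin
  order (filterᵇ (member β) r)
    ≡⟨ cong order (without-member a∉β r) ⟨
  order (without a (filterᵇ (member (a ∷ β)) r))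
    ≡⟨ order-filter _ (filterᵇ (member (a ∷ β)) r) ⟩
  without a (order (filterᵇ (member (a ∷ β)) r))
    ≡⟨ cong (without a) eq ⟩
  without a (a ∷ β)
    ≡⟨ filterᵇ-false _ (cong not (eqL-refl a)) β ⟩
  without a β
    ≡⟨ without-∉ a∉β ⟩
  β ∎

-- The order of first occurrences is determined by which letter of each of its
-- terminal segments comes first.
foata-order-restricted : ∀ {m} c (β : Word m) → Unique β → ConvexTails β → ∀ r →
  order (filterᵇ (member β) r) ≡ β → order (filterᵇ (member β) (foata c r)) ≡ β
foata-order-restricted c [] _ _ r _ = cong order (filter-none (T? ∘ member []) {foata c r} (All.universal (λ _ ()) _))
foata-order-restricted c (a ∷ β) (a# ∷ u) (conv , convs) r eq = go _ refl first
  where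
  a∉β : a ∉ β
  a∉β = All¬⇒¬Any a#
  ih : order (filterᵇ (member β) (foata c r)) ≡ β
  ih = foata-order-restricted c β u convs r (filter-order-≡ a∉β r eq)
  first : head (filterᵇ (member (a ∷ β)) (foata c r)) ≡ just a
  first = trans (foata-head c (member (a ∷ β)) conv r)
    (trans (sym (head-order (filterᵇ (member (a ∷ β)) r))) (cong head eq))
  go : ∀ s → filterᵇ (member (a ∷ β)) (foata c r) ≡ s → head s ≡ just a → order s ≡ a ∷ β
  -- With `a` known to come first, deleting it leaves the subword on the letters of `β`, where the
  -- induction hypothesis applies.
  go (.a ∷ t) e refl = cong (a ∷_) (begin
    without a (order t)                     ≡⟨ order-filter _ t ⟨
    order (without a t)                     ≡⟨ cong order (filterᵇ-false _ (cong not (eqL-refl a)) t) ⟨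
    order (without a (a ∷ t))               ≡⟨ cong (order ∘ without a) e ⟨
    order (without a (filterᵇ (member (a ∷ β)) (foata c r)))
                                            ≡⟨ cong order (without-member a∉β (foata c r)) ⟩
    order (filterᵇ (member β) (foata c r))  ≡⟨ ih ⟩
    β                                       ∎)

foata-order : ∀ {m} c {ρ : Word m} → Unique ρ → (∀ a → a ∈ ρ) → ConvexTails ρ → ∀ {r} →
  order r ≡ ρ → order (foata c r) ≡ ρ
foata-order c {ρ} u complete convs {r} eq = begin
  order (foata c r)                          ≡⟨ cong order (all-members (foata c r)) ⟨
  order (filterᵇ (member ρ) (foata c r))
    ≡⟨ foata-order-restricted c ρ u convs r (trans (cong order (all-members r)) eq) ⟩
  ρ                                          ∎
  where
  all-members : ∀ s → filterᵇ (member ρ) s ≡ s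
  all-members s = filterᵇ-id (member ρ) s (λ {z} _ → member-true (complete z))

-- The tail permutation as a reversed order of first occurrences

any-∷ʳ : {A : Set} (p : A → Bool) (w : List A) (x : A) → any p (w ∷ʳ x) ≡ any p w ∨ p x
any-∷ʳ p [] x = ∨-identityʳ (p x)
any-∷ʳ p (y ∷ w) x = trans (cong (p y ∨_) (any-∷ʳ p w x)) (sym (∨-assoc (p y) (any p w) (p x)))

tailPerm-∷ʳ : ∀ {m} (w : Word m) x → tailPerm (w ∷ʳ x) ≡ without x (tailPerm w) ∷ʳ x
tailPerm-∷ʳ [] x = refl
tailPerm-∷ʳ (y ∷ w) x with any (eqL y) w | any-∷ʳ (eqL y) w x
... | true | e = trans (cong (if_then tailPerm (w ∷ʳ x) else y ∷ tailPerm (w ∷ʳ x)) e) (tailPerm-∷ʳ w x)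
... | false | e with y Fin.≟ x
...   | yes refl = begin
  tailPerm (y ∷ w ∷ʳ y)                ≡⟨ cong (if_then tailPerm (w ∷ʳ y) else y ∷ tailPerm (w ∷ʳ y)) (trans e (eqL-refl y)) ⟩
  tailPerm (w ∷ʳ y)                    ≡⟨ tailPerm-∷ʳ w y ⟩
  without y (tailPerm w) ∷ʳ y          ≡⟨ cong (_∷ʳ y) (filterᵇ-false _ (cong not (eqL-refl y)) (tailPerm w)) ⟨
  without y (y ∷ tailPerm w) ∷ʳ y      ∎
...   | no ne = begin
  tailPerm (y ∷ w ∷ʳ x)                ≡⟨ cong (if_then tailPerm (w ∷ʳ x) else y ∷ tailPerm (w ∷ʳ x)) (trans e (eqL-false ne)) ⟩
  y ∷ tailPerm (w ∷ʳ x)                ≡⟨ cong (y ∷_) (tailPerm-∷ʳ w x) ⟩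
  y ∷ without x (tailPerm w) ∷ʳ x      ≡⟨ cong (_∷ʳ x) (filterᵇ-true _ (cong not (eqL-false (ne ∘ sym))) (tailPerm w)) ⟨
  without x (y ∷ tailPerm w) ∷ʳ x      ∎

filterᵇ-reverse : {A : Set} (p : A → Bool) → ∀ xs → filterᵇ p (reverse xs) ≡ reverse (filterᵇ p xs)
filterᵇ-reverse p [] = refl
filterᵇ-reverse p (x ∷ xs) = begin
  filterᵇ p (reverse (x ∷ xs))                        ≡⟨ cong (filterᵇ p) (unfold-reverse x xs) ⟩
  filterᵇ p (reverse xs ∷ʳ x)                         ≡⟨ filter-++ (T? ∘ p) (reverse xs) (x ∷ []) ⟩
  filterᵇ p (reverse xs) ++ filterᵇ p (x ∷ [])        ≡⟨ cong (_++ filterᵇ p (x ∷ [])) (filterᵇ-reverse p xs) ⟩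
  reverse (filterᵇ p xs) ++ filterᵇ p (x ∷ [])        ≡⟨ step (p x) refl ⟩
  reverse (filterᵇ p (x ∷ xs))                        ∎
  where
  step : ∀ b → p x ≡ b → reverse (filterᵇ p xs) ++ filterᵇ p (x ∷ []) ≡ reverse (filterᵇ p (x ∷ xs))
  step true eq = begin
    reverse (filterᵇ p xs) ++ filterᵇ p (x ∷ []) ≡⟨ cong (reverse (filterᵇ p xs) ++_) (filterᵇ-true p eq []) ⟩
    reverse (filterᵇ p xs) ∷ʳ x                  ≡⟨ unfold-reverse x (filterᵇ p xs) ⟨
    reverse (x ∷ filterᵇ p xs)                   ≡⟨ cong reverse (filterᵇ-true p eq xs) ⟨
    reverse (filterᵇ p (x ∷ xs))                 ∎
  step false eq = begin
    reverse (filterᵇ p xs) ++ filterᵇ p (x ∷ []) ≡⟨ cong (reverse (filterᵇ p xs) ++_) (filterᵇ-false p eq []) ⟩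
    reverse (filterᵇ p xs) ++ []                 ≡⟨ ++-identityʳ _ ⟩
    reverse (filterᵇ p xs)                       ≡⟨ cong reverse (filterᵇ-false p eq xs) ⟨
    reverse (filterᵇ p (x ∷ xs))                 ∎

tailPerm-reverse : ∀ {m} (r : Word m) → tailPerm (reverse r) ≡ reverse (order r)
tailPerm-reverse [] = refl
tailPerm-reverse (x ∷ r) = begin
  tailPerm (reverse (x ∷ r))                 ≡⟨ cong tailPerm (unfold-reverse x r) ⟩
  tailPerm (reverse r ∷ʳ x)                  ≡⟨ tailPerm-∷ʳ (reverse r) x ⟩
  without x (tailPerm (reverse r)) ∷ʳ x      ≡⟨ cong (λ w → without x w ∷ʳ x) (tailPerm-reverse r) ⟩
  without x (reverse (order r)) ∷ʳ x         ≡⟨ cong (_∷ʳ x) (filterᵇ-reverse _ (order r)) ⟩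
  reverse (without x (order r)) ∷ʳ x         ≡⟨ unfold-reverse x (without x (order r)) ⟨
  reverse (order (x ∷ r))                    ∎

-- Profiles

-- The profile of a reversed word lists its letters in order of first
-- occurrence, an entry (a , κ) standing for κ + 1 copies of a.
Profile : ℕ → Set
Profile m = List (Fin m × ℕ)

keys : ∀ {m} → Profile m → Word m
keys = map proj₁

copies : ∀ {m} → Fin m → Profile m → ℕ
copies a []            = 0
copies a ((b , κ) ∷ t) = if eqL a b then suc κ else copies a t

remove : ∀ {m} → Fin m → Profile m → Profile m
remove a = filterᵇ (λ e → not (eqL a (proj₁ e)))

-- The entry of `x` moves to the front. As an entry stands for one copy more than its number, that
-- number is exactly the count of `x` in the rest.
profile : ∀ {m} → Word m → Profile m
profile []      = []
profile (x ∷ r) = (x , copies x (profile r)) ∷ remove x (profile r)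

weight : ∀ {m} → Profile m → ℕ
weight t = sum (map (suc ∘ proj₂) t)

copies-here : ∀ {m} (a : Fin m) κ t → copies a ((a , κ) ∷ t) ≡ suc κ
copies-here a κ t = cong (if_then suc κ else copies a t) (eqL-refl a)

copies-there : ∀ {m} {a b : Fin m} → a ≢ b → ∀ κ t → copies a ((b , κ) ∷ t) ≡ copies a t
copies-there {a = a} {b} ne κ t = cong (if_then suc κ else copies a t) (eqL-false {a = a} {b} ne)

remove-here : ∀ {m} (a : Fin m) κ t → remove a ((a , κ) ∷ t) ≡ remove a t
remove-here a κ t = filterᵇ-false _ (cong not (eqL-refl a)) t

remove-there : ∀ {m} {a b : Fin m} → a ≢ b → ∀ κ t → remove a ((b , κ) ∷ t) ≡ (b , κ) ∷ remove a t
remove-there {a = a} {b} ne κ t = filterᵇ-true _ (cong not (eqL-false {a = a} {b} ne)) t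

remove-∉ : ∀ {m} {a : Fin m} {t} → a ∉ keys t → remove a t ≡ t
remove-∉ {a = a} {t} a∉ = filterᵇ-id _ t (λ {e} e∈ → cong not
  (eqL-false {a = a} {proj₁ e} (λ { refl → a∉ (∈-map⁺ proj₁ e∈) })))

copies-∉ : ∀ {m} {a : Fin m} t → a ∉ keys t → copies a t ≡ 0
copies-∉ [] _ = refl
copies-∉ {a = a} ((b , κ) ∷ t) a∉ = trans (copies-there (λ { refl → a∉ (here refl) }) κ t) (copies-∉ t (a∉ ∘ there))

copies-zero : ∀ {m} {a : Fin m} t → copies a t ≡ 0 → a ∉ keys t
copies-zero {a = a} ((.a , κ) ∷ t) eq (here refl) = contradiction (trans (sym eq) (copies-here a κ t)) λ ()
copies-zero {a = a} ((b , κ) ∷ t) eq (there a∈) with a Fin.≟ b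
... | yes refl = contradiction (trans (sym eq) (copies-here a κ t)) λ ()
... | no ne = copies-zero t (trans (sym (copies-there ne κ t)) eq) a∈

copies-remove : ∀ {m} {a b : Fin m} → a ≢ b → ∀ t → copies a (remove b t) ≡ copies a t
copies-remove ne [] = refl
copies-remove {a = a} {b} ne ((c , κ) ∷ t) with b Fin.≟ c
... | yes refl = trans (cong (copies a) (remove-here b κ t))
  (trans (copies-remove ne t) (sym (copies-there ne κ t)))
... | no b≢c = trans (cong (copies a) (remove-there b≢c κ t))
  (cong (if eqL a c then suc κ else_) (copies-remove ne t))

keys-remove : ∀ {m} (a : Fin m) t → keys (remove a t) ≡ without a (keys t)
keys-remove a t = filterᵇ-map (λ z → not (eqL a z)) proj₁ t

keys-profile : ∀ {m} (r : Word m) → keys (profile r) ≡ order r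
keys-profile [] = refl
keys-profile (x ∷ r) = cong (x ∷_) (trans (keys-remove x (profile r)) (cong (without x) (keys-profile r)))

profile-unique : ∀ {m} (r : Word m) → Unique (keys (profile r))
profile-unique r = subst Unique (sym (keys-profile r)) (order-unique r)

mult-here : ∀ {m} (a : Fin m) r → mult a (a ∷ r) ≡ suc (mult a r)
mult-here a r = trans (countᵇ-∷ (eqL a) a r) (cong (λ b → ind b + mult a r) (eqL-refl a))

mult-there : ∀ {m} {a b : Fin m} → a ≢ b → ∀ r → mult a (b ∷ r) ≡ mult a r
mult-there {a = a} {b} ne r = trans (countᵇ-∷ (eqL a) b r) (cong (λ c → ind c + mult a r) (eqL-false {a = a} {b} ne))

copies-profile : ∀ {m} (a : Fin m) r → copies a (profile r) ≡ mult a r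
copies-profile a [] = refl
copies-profile a (x ∷ r) with a Fin.≟ x
... | yes refl = trans (copies-here a _ (remove a (profile r)))
  (trans (cong suc (copies-profile a r)) (sym (mult-here a r)))
... | no ne = trans (copies-there ne _ (remove x (profile r)))
  (trans (copies-remove ne (profile r)) (trans (copies-profile a r) (sym (mult-there ne r))))

remove-profile : ∀ {m} (a : Fin m) r → remove a (profile r) ≡ profile (without a r)
remove-profile a [] = refl
remove-profile a (x ∷ r) with a Fin.≟ x
... | yes refl = begin
  remove a ((a , copies a (profile r)) ∷ remove a (profile r))
    ≡⟨ remove-here a _ (remove a (profile r)) ⟩
  remove a (remove a (profile r))
    ≡⟨ filter-idem _ (profile r) ⟩
  remove a (profile r)
    ≡⟨ remove-profile a r ⟩
  profile (without a r)
    ≡⟨ cong profile (filterᵇ-false _ (cong not (eqL-refl a)) r) ⟨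
  profile (without a (a ∷ r)) ∎
... | no ne = begin
  remove a ((x , copies x (profile r)) ∷ remove x (profile r))
    ≡⟨ remove-there ne _ (remove x (profile r)) ⟩
  (x , copies x (profile r)) ∷ remove a (remove x (profile r))
    ≡⟨ cong₂ (λ κ t → (x , κ) ∷ t) (sym (copies-remove (ne ∘ sym) (profile r))) (filterᵇ-comm _ _ (profile r)) ⟩
  (x , copies x (remove a (profile r))) ∷ remove x (remove a (profile r))
    ≡⟨ cong (λ t → (x , copies x t) ∷ remove x t) (remove-profile a r) ⟩
  profile (x ∷ without a r)
    ≡⟨ cong profile (filterᵇ-true _ (cong not (eqL-false {a = a} {x} ne)) r) ⟨
  profile (without a (x ∷ r)) ∎

profile-cons-injective : ∀ {m} {x a : Fin m} {κ} {t} r → profile (x ∷ r) ≡ (a , κ) ∷ t →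
  x ≡ a × copies a (profile r) ≡ κ × remove a (profile r) ≡ t
profile-cons-injective r refl = refl , refl , refl

profile-by-copies : ∀ {m} (t : Profile m) → Unique (keys t) →
  t ≡ map (λ a → a , pred (copies a t)) (keys t)
profile-by-copies [] _ = refl
profile-by-copies ((b , κ) ∷ t) (b# ∷ u) = cong₂ _∷_
  (cong (λ n → b , pred n) (sym (copies-here b κ t)))
  (trans (profile-by-copies t u) (map-cong-local (All.map
    (λ {a} b≢a → cong (λ n → a , pred n) (sym (copies-there (b≢a ∘ sym) κ t))) b#)))

profileOf : ∀ {m} → (Fin m → ℕ) → Word m → Profile m
profileOf k ρ = map (λ a → a , pred (k a)) ρ

profile⁺ : ∀ {m} (k : Fin m → ℕ) {ρ r} → order r ≡ ρ → (∀ a → mult a r ≡ k a) → profile r ≡ profileOf k ρ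
profile⁺ k {ρ} {r} ord cont = begin
  profile r
    ≡⟨ profile-by-copies (profile r) (profile-unique r) ⟩
  map (λ a → a , pred (copies a (profile r))) (keys (profile r))
    ≡⟨ cong (map _) (trans (keys-profile r) ord) ⟩
  map (λ a → a , pred (copies a (profile r))) ρ
    ≡⟨ map-cong (λ a → cong (λ n → a , pred n) (trans (copies-profile a r) (cont a))) ρ ⟩
  profileOf k ρ ∎

keys-profileOf : ∀ {m} (k : Fin m → ℕ) ρ → keys (profileOf k ρ) ≡ ρ
keys-profileOf k ρ = trans (sym (map-∘ ρ)) (map-id ρ)

copies-profileOf : ∀ {m} (k : Fin m → ℕ) → (∀ a → 1 ≤ k a) → ∀ {ρ a} → a ∈ ρ → copies a (profileOf k ρ) ≡ k a
copies-profileOf k k≥1 {b ∷ ρ} {a} a∈ with a Fin.≟ b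
... | yes refl = trans (copies-here a (pred (k a)) (profileOf k ρ)) (suc-pred (k a) {{>-nonZero (k≥1 a)}})
copies-profileOf k k≥1 {b ∷ ρ} {a} (here eq) | no ne = contradiction eq ne
copies-profileOf k k≥1 {b ∷ ρ} {a} (there a∈) | no ne =
  trans (copies-there ne (pred (k b)) (profileOf k ρ)) (copies-profileOf k k≥1 a∈)

-- Together with `profile⁺` this makes one prescribed profile out of the two conditions that define
-- the class. Positivity of `k` enters because an entry always encodes at least one copy.
profile⁻ : ∀ {m} (k : Fin m → ℕ) → (∀ a → 1 ≤ k a) → ∀ {ρ r} → (∀ a → a ∈ ρ) →
  profile r ≡ profileOf k ρ → order r ≡ ρ × (∀ a → mult a r ≡ k a)
profile⁻ k k≥1 {ρ} {r} complete eq =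
  trans (sym (keys-profile r)) (trans (cong keys eq) (keys-profileOf k ρ)) ,
  λ a → trans (sym (copies-profile a r)) (trans (cong (copies a) eq) (copies-profileOf k k≥1 (complete a)))

-- Enumeration by the first letter

insertions : {A : Set} → A → List A → List (List A)
insertions x []       = (x ∷ []) ∷ []
insertions x (y ∷ ys) = (x ∷ y ∷ ys) ∷ map (y ∷_) (insertions x ys)

insertions-↭ : {A : Set} (x : A) (ys : List A) {t : List A} → t ∈ insertions x ys → t ↭ x ∷ ys
insertions-↭ x [] (here refl) = ↭-refl
insertions-↭ x (y ∷ ys) (here refl) = ↭-refl
insertions-↭ x (y ∷ ys) (there t∈) with s , s∈ , refl ← ∈-map⁻ (y ∷_) t∈ =
  ↭-trans (prep y (insertions-↭ x ys s∈)) (swap y x ↭-refl)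

insertions-unique : {A : Set} {x : A} {ys : List A} → x ∉ ys → Unique (insertions x ys)
insertions-unique {ys = []} _ = [] ∷ []
insertions-unique {x = x} {y ∷ ys} x∉ =
  ¬Any⇒All¬ _ (λ p → let _ , _ , eq = ∈-map⁻ (y ∷_) p in x∉ (here (∷-injectiveˡ eq)))
  ∷ Unique.map⁺ ∷-injectiveʳ (insertions-unique (x∉ ∘ there))

keys-insertions : ∀ {m} {a : Fin m} {κ} t {s} → Unique (a ∷ keys t) → s ∈ insertions (a , κ) t → Unique (keys s)
keys-insertions {a = a} {κ} t u s∈ = AllPairs-resp-↭ (setoid _) (λ ne → ne ∘ sym) ((λ { refl → id }) , λ { refl → id })
  (↭⇒↭ₛ (↭-sym (map⁺ proj₁ (insertions-↭ (a , κ) t s∈)))) u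

remove-insertions : ∀ {m} {a : Fin m} {κ} t {s} → a ∉ keys t → s ∈ insertions (a , κ) t →
  copies a s ≡ suc κ × remove a s ≡ t
remove-insertions {a = a} {κ} [] _ (here refl) = copies-here a κ [] , remove-here a κ []
remove-insertions {a = a} {κ} (e ∷ t) a∉ (here refl) =
  copies-here a κ (e ∷ t) , trans (remove-here a κ (e ∷ t)) (remove-∉ a∉)
remove-insertions {a = a} {κ} ((b , l) ∷ t) a∉ (there s∈)
  with s , s∈′ , refl ← ∈-map⁻ ((b , l) ∷_) s∈
  with c , d ← remove-insertions t (a∉ ∘ there) s∈′ =
  trans (copies-there ne l s) c , trans (remove-there ne l s) (cong ((b , l) ∷_) d)
  where
  ne : a ≢ b
  ne refl = a∉ (here refl)

insertions-remove : ∀ {m} {a : Fin m} {κ} s → Unique (keys s) → copies a s ≡ suc κ →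
  s ∈ insertions (a , κ) (remove a s)
insertions-remove {a = a} ((b , l) ∷ s) (b# ∷ u) eq with a Fin.≟ b
... | yes refl with refl ← trans (sym (copies-here a l s)) eq =
  subst (λ t → (a , l) ∷ s ∈ insertions (a , l) t)
    (sym (trans (remove-here a l s) (remove-∉ (All¬⇒¬Any b#)))) (first s)
  where
  first : ∀ t → (a , l) ∷ t ∈ insertions (a , l) t
  first []      = here refl
  first (_ ∷ _) = here refl
... | no ne = subst (λ t → (b , l) ∷ s ∈ insertions _ t) (sym (remove-there ne l s))
  (there (∈-map⁺ ((b , l) ∷_) (insertions-remove s u (trans (sym (copies-there ne l s)) eq))))

-- If copies of `a` remain after its first occurrence, their own first occurrence may come anywhere
-- among those of the other letters, whence the insertions. These do not shrink the list, so the
-- recursion runs on the word length.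
words : ∀ {m} → ℕ → Profile m → List (Word m)
words zero    []                  = [] ∷ []
words zero    (_ ∷ _)             = []
words (suc n) []                  = []
words (suc n) ((a , zero)  ∷ t)   = map (a ∷_) (words n t)
words (suc n) ((a , suc κ) ∷ t)   = map (a ∷_) (concatMap (words n) (insertions (a , κ) t))

words-sound : ∀ {m} n (t : Profile m) → Unique (keys t) → ∀ {r} → r ∈ words n t →
  profile r ≡ t × length r ≡ n
words-sound zero [] _ (here refl) = refl , refl
words-sound (suc n) ((a , zero) ∷ t) (a# ∷ u) r∈
  with s , s∈ , refl ← ∈-map⁻ (a ∷_) r∈
  with refl , len ← words-sound n t u s∈ =
  cong₂ (λ κ t → (a , κ) ∷ t) (copies-∉ t (All¬⇒¬Any a#)) (remove-∉ (All¬⇒¬Any a#)) , cong suc len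
words-sound (suc n) ((a , suc κ) ∷ t) (a# ∷ u) r∈
  with s , s∈ , refl ← ∈-map⁻ (a ∷_) r∈
  with t′ , t′∈ , s∈′ ← find (∈-concatMap⁻ (words n) {insertions (a , κ) t} s∈)
  with refl , len ← words-sound n t′ (keys-insertions t (a# ∷ u) t′∈) s∈′
  with c , d ← remove-insertions t (All¬⇒¬Any a#) t′∈ =
  cong₂ (λ κ t → (a , κ) ∷ t) c d , cong suc len

words-complete : ∀ {m} (r : Word m) t → profile r ≡ t → r ∈ words (length r) t
words-complete [] [] eq = here refl
words-complete (x ∷ r) ((a , κ) ∷ t) eq with profile-cons-injective r eq
words-complete (x ∷ r) ((.x , zero) ∷ t) eq | refl , c , d =
  ∈-map⁺ (x ∷_) (words-complete r t (trans (sym (remove-∉ (copies-zero (profile r) c))) d))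
words-complete (x ∷ r) ((.x , suc κ) ∷ t) eq | refl , c , d =
  ∈-map⁺ (x ∷_) (∈-concatMap⁺ (words (length r)) (lose
    (subst (λ t → profile r ∈ insertions (x , κ) t) d (insertions-remove (profile r) (profile-unique r) c))
    (words-complete r (profile r) refl)))

words-unique : ∀ {m} n (t : Profile m) → Unique (keys t) → Unique (words n t)
words-unique zero [] _ = [] ∷ []
words-unique zero (_ ∷ _) _ = []
words-unique (suc n) [] _ = []
words-unique (suc n) ((a , zero) ∷ t) (_ ∷ u) = Unique.map⁺ ∷-injectiveʳ (words-unique n t u)
words-unique (suc n) ((a , suc κ) ∷ t) u@(a# ∷ _) = Unique.map⁺ ∷-injectiveʳ
  (unique-concatMap (words n) (insertions-unique (All¬⇒¬Any a# ∘ ∈-map⁺ proj₁))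
    (λ {s} s∈ → words-unique n s (keys-insertions t u s∈))
    -- Different insertions give disjoint lists because a word determines its profile.
    (λ {s} {s′} s∈ s′∈ z∈ z∈′ → trans
      (sym (proj₁ (words-sound n s (keys-insertions t u s∈) z∈)))
      (proj₁ (words-sound n s′ (keys-insertions t u s′∈) z∈′))))

-- Enumeration by shuffles

shuffles : ∀ {m} → Fin m → ℕ → Word m → List (Word m)
shuffles a zero    w       = w ∷ []
shuffles a (suc κ) []      = map (a ∷_) (shuffles a κ [])
shuffles a (suc κ) (x ∷ w) = map (a ∷_) (shuffles a κ (x ∷ w)) ++ map (x ∷_) (shuffles a (suc κ) w)

shuffles-sound : ∀ {m} (a : Fin m) κ w → a ∉ w → ∀ {v} → v ∈ shuffles a κ w →
  mult a v ≡ κ × without a v ≡ w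
shuffles-sound a zero w a∉ (here refl) = mult-∉ w a∉ , without-∉ a∉
  where
  mult-∉ : ∀ w → a ∉ w → mult a w ≡ 0
  mult-∉ [] _ = refl
  mult-∉ (b ∷ w) a∉ = trans (mult-there {a = a} {b} (λ { refl → a∉ (here refl) }) w) (mult-∉ w (a∉ ∘ there))
shuffles-sound a (suc κ) w a∉ v∈ = go w a∉ v∈
  where
  via-a : ∀ {w v} → a ∉ w → v ∈ map (a ∷_) (shuffles a κ w) → mult a v ≡ suc κ × without a v ≡ w
  via-a {w} a∉ v∈ with u , u∈ , refl ← ∈-map⁻ (a ∷_) v∈ with c , d ← shuffles-sound a κ w a∉ u∈ =
    trans (mult-here a u) (cong suc c) , trans (filterᵇ-false _ (cong not (eqL-refl a)) u) d
  go : ∀ w {v} → a ∉ w → v ∈ shuffles a (suc κ) w → mult a v ≡ suc κ × without a v ≡ w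
  go [] a∉ v∈ = via-a a∉ v∈
  go (x ∷ w) a∉ v∈ with ∈-++⁻ (map (a ∷_) (shuffles a κ (x ∷ w))) v∈
  ... | inj₁ p = via-a a∉ p
  ... | inj₂ p with u , u∈ , refl ← ∈-map⁻ (x ∷_) p with c , d ← go w (a∉ ∘ there) u∈ =
    trans (mult-there ne u) c ,
    trans (filterᵇ-true _ (cong not (eqL-false {a = a} {x} ne)) u) (cong (x ∷_) d)
    where
    ne : a ≢ x
    ne refl = a∉ (here refl)

shuffles-a∷ : ∀ {m} (a : Fin m) κ w {v} → v ∈ shuffles a κ w → a ∷ v ∈ shuffles a (suc κ) w
shuffles-a∷ a κ []      v∈ = ∈-map⁺ (a ∷_) v∈
shuffles-a∷ a κ (x ∷ w) v∈ = ∈-++⁺ˡ (∈-map⁺ (a ∷_) v∈)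

shuffles-x∷ : ∀ {m} (a x : Fin m) κ w {v} → v ∈ shuffles a κ w → x ∷ v ∈ shuffles a κ (x ∷ w)
shuffles-x∷ a x zero    w (here refl) = here refl
shuffles-x∷ a x (suc κ) w v∈ = ∈-++⁺ʳ (map (a ∷_) (shuffles a κ (x ∷ w))) (∈-map⁺ (x ∷_) v∈)

shuffles-complete : ∀ {m} (a : Fin m) v → v ∈ shuffles a (mult a v) (without a v)
shuffles-complete a [] = here refl
shuffles-complete a (x ∷ v) with a Fin.≟ x
... | yes refl = subst₂ (λ κ w → a ∷ v ∈ shuffles a κ w)
  (sym (mult-here a v)) (sym (filterᵇ-false _ (cong not (eqL-refl a)) v))
  (shuffles-a∷ a (mult a v) (without a v) (shuffles-complete a v))
... | no ne = subst₂ (λ κ w → x ∷ v ∈ shuffles a κ w)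
  (sym (mult-there ne v)) (sym (filterᵇ-true _ (cong not (eqL-false {a = a} {x} ne)) v))
  (shuffles-x∷ a x (mult a v) (without a v) (shuffles-complete a v))

shuffles-unique : ∀ {m} (a : Fin m) κ w → a ∉ w → Unique (shuffles a κ w)
shuffles-unique a zero w _ = [] ∷ []
shuffles-unique a (suc κ) [] a∉ = Unique.map⁺ ∷-injectiveʳ (shuffles-unique a κ [] a∉)
shuffles-unique a (suc κ) (x ∷ w) a∉ = Unique.++⁺
  (Unique.map⁺ ∷-injectiveʳ (shuffles-unique a κ (x ∷ w) a∉))
  (Unique.map⁺ ∷-injectiveʳ (shuffles-unique a (suc κ) w (a∉ ∘ there)))
  λ { (p , p′) → let _ , _ , e = ∈-map⁻ (a ∷_) p ; _ , _ , e′ = ∈-map⁻ (x ∷_) p′ in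
      a∉ (here (∷-injectiveˡ (trans (sym e) e′))) }

-- All copies of the first key are treated at once, so that the recursion passes to a tail of the
-- keys, for which `ConvexTails` is inherited.
shuffleWords : ∀ {m} → Profile m → List (Word m)
shuffleWords []            = [] ∷ []
shuffleWords ((a , κ) ∷ t) = concatMap (λ w → map (a ∷_) (shuffles a κ w)) (shuffleWords t)

∈-order⁺ : ∀ {m} {a : Fin m} r → a ∈ r → a ∈ order r
∈-order⁺ (x ∷ r) (here refl) = here refl
∈-order⁺ {a = a} (x ∷ r) (there a∈) with a Fin.≟ x
... | yes refl = here refl
... | no ne = there (∈-filterᵇ⁺ _ (∈-order⁺ r a∈) (cong not (eqL-false {a = x} {a} (ne ∘ sym))))

-- Announced ahead of its proof: the induction step needs `a` to be absent from the words for `t`,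
-- and that absence is read off from soundness for `t`.
shuffleWords-sound : ∀ {m} (t : Profile m) → Unique (keys t) → ∀ {r} → r ∈ shuffleWords t → profile r ≡ t

∉-shuffleWords : ∀ {m} (t : Profile m) {a} → Unique (keys t) → a ∉ keys t → ∀ {w} → w ∈ shuffleWords t → a ∉ w
∉-shuffleWords t u a∉ {w} w∈ a∈ =
  a∉ (subst (_ ∈_) (trans (sym (keys-profile w)) (cong keys (shuffleWords-sound t u w∈))) (∈-order⁺ w a∈))

shuffleWords-sound [] _ (here refl) = refl
shuffleWords-sound ((a , κ) ∷ t) (a# ∷ u) r∈
  with w , w∈ , p ← find (∈-concatMap⁻ (λ w → map (a ∷_) (shuffles a κ w)) {shuffleWords t} r∈)
  with v , v∈ , refl ← ∈-map⁻ (a ∷_) p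
  with c , d ← shuffles-sound a κ w (∉-shuffleWords t u (All¬⇒¬Any a#) w∈) v∈ =
  cong₂ (λ κ t → (a , κ) ∷ t) (trans (copies-profile a v) c)
    (trans (remove-profile a v) (trans (cong profile d) (shuffleWords-sound t u w∈)))

shuffleWords-complete : ∀ {m} (t : Profile m) r → profile r ≡ t → r ∈ shuffleWords t
shuffleWords-complete [] [] eq = here refl
shuffleWords-complete ((a , κ) ∷ t) (x ∷ r) eq with refl , c , d ← profile-cons-injective r eq =
  ∈-concatMap⁺ _ (lose (shuffleWords-complete t (without a r) (trans (sym (remove-profile a r)) d))
    (∈-map⁺ (a ∷_) (subst (λ κ → r ∈ shuffles a κ (without a r)) (trans (sym (copies-profile a r)) c)
      (shuffles-complete a r))))

shuffleWords-unique : ∀ {m} (t : Profile m) → Unique (keys t) → Unique (shuffleWords t)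
shuffleWords-unique [] _ = [] ∷ []
shuffleWords-unique ((a , κ) ∷ t) (a# ∷ u) =
  unique-concatMap _ (shuffleWords-unique t u)
    (λ {w} w∈ → Unique.map⁺ ∷-injectiveʳ (shuffles-unique a κ w (avoids w∈)))
    λ {w} {w′} w∈ w′∈ z∈ z∈′ → same w∈ w′∈ (∈-map⁻ (a ∷_) z∈) (∈-map⁻ (a ∷_) z∈′)
  where
  avoids : ∀ {w} → w ∈ shuffleWords t → a ∉ w
  avoids = ∉-shuffleWords t u (All¬⇒¬Any a#)
  same : ∀ {w w′ z} → w ∈ shuffleWords t → w′ ∈ shuffleWords t →
    (∃ λ v → v ∈ shuffles a κ w × z ≡ a ∷ v) → (∃ λ v → v ∈ shuffles a κ w′ × z ≡ a ∷ v) → w ≡ w′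
  same {w} {w′} w∈ w′∈ (v , v∈ , refl) (.v , v∈′ , refl) =
    trans (sym (proj₂ (shuffles-sound a κ w (avoids w∈) v∈)))
          (proj₂ (shuffles-sound a κ w′ (avoids w′∈) v∈′))

-- Sums over the alphabet, and Z read from the right end of the word

ΣFin : ∀ m → (Fin m → ℕ) → ℕ
ΣFin m f = sum (map f (allFin m))

module _ {A : Set} where

  sum-map-cong : (xs : List A) {f g : A → ℕ} → (∀ {x} → x ∈ xs → f x ≡ g x) → sum (map f xs) ≡ sum (map g xs)
  sum-map-cong xs eq = cong sum (map-cong-local (All.tabulate eq))

  sum-map-zero : (xs : List A) {f : A → ℕ} → (∀ x → f x ≡ 0) → sum (map f xs) ≡ 0
  sum-map-zero [] _ = refl
  sum-map-zero (x ∷ xs) eq = cong₂ _+_ (eq x) (sum-map-zero xs eq)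

  sum-map-+ : (xs : List A) (f g : A → ℕ) → sum (map (λ x → f x + g x) xs) ≡ sum (map f xs) + sum (map g xs)
  sum-map-+ [] f g = refl
  sum-map-+ (x ∷ xs) f g = trans (cong (f x + g x +_) (sum-map-+ xs f g))
    (lem (f x) (g x) (sum (map f xs)) (sum (map g xs)))
    where
    lem : ∀ a b c d → a + b + (c + d) ≡ a + c + (b + d)
    lem = solve-∀

  sum-map-* : (xs : List A) (c : ℕ) (f : A → ℕ) → sum (map (λ x → c * f x) xs) ≡ c * sum (map f xs)
  sum-map-* [] c f = sym (*-zeroʳ c)
  sum-map-* (x ∷ xs) c f = trans (cong (c * f x +_) (sum-map-* xs c f)) (sym (*-distribˡ-+ c (f x) _))

  sum-concatMap : {B : Set} (f : A → List B) (g : B → ℕ) (xs : List A) →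
    sum (map g (concatMap f xs)) ≡ sum (map (λ x → sum (map g (f x))) xs)
  sum-concatMap f g [] = refl
  sum-concatMap f g (x ∷ xs) = begin
    sum (map g (f x ++ concatMap f xs))               ≡⟨ cong sum (map-++ g (f x) _) ⟩
    sum (map g (f x) ++ map g (concatMap f xs))       ≡⟨ sum-++ (map g (f x)) _ ⟩
    sum (map g (f x)) + sum (map g (concatMap f xs))  ≡⟨ cong (sum (map g (f x)) +_) (sum-concatMap f g xs) ⟩
    sum (map g (f x)) + sum (map (λ x → sum (map g (f x))) xs) ∎

ΣFin-delta : ∀ {m} (x : Fin m) (c : Fin m → ℕ) → ΣFin m (λ a → if eqL a x then c a else 0) ≡ c x
ΣFin-delta {m} x c = go (allFin m) (Unique.allFin⁺ m) (∈-allFin x)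
  where
  f : Fin m → ℕ
  f a = if eqL a x then c a else 0
  off : ∀ as → x ∉ as → sum (map f as) ≡ 0
  off [] _ = refl
  off (a ∷ as) x∉ = cong₂ _+_ (cong (if_then c a else 0) (eqL-false {a = a} {x} (λ { refl → x∉ (here refl) })))
    (off as (x∉ ∘ there))
  go : ∀ as → Unique as → x ∈ as → sum (map f as) ≡ c x
  go (a ∷ as) (a# ∷ u) (here refl) = trans
    (cong₂ _+_ (cong (if_then c a else 0) (eqL-refl a)) (off as (All¬⇒¬Any a#))) (+-identityʳ (c a))
  go (a ∷ as) (a# ∷ u) (there x∈) = cong₂ _+_
    (cong (if_then c a else 0) (eqL-false {a = a} {x} (All.lookup a# x∈))) (go as u x∈)

-- The increments of Z

zTerm : ∀ {m} → Fin m → Fin m → Word m → ℕ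
zTerm a b r = if bigger a b then majd 0 (sub a b r) else 0

zStat : ∀ {m} → Word m → ℕ
zStat {m} r = ΣFin m (λ a → ΣFin m (λ b → zTerm a b r))

Z-reverse : ∀ {m} (r : Word m) → Z (reverse r) ≡ zStat r
Z-reverse {m} r = begin
  Z (reverse r)
    ≡⟨ cong sum (map-id (concatMap (λ a → map (T′ a) (allFin m)) (allFin m))) ⟨
  sum (map id (concatMap (λ a → map (T′ a) (allFin m)) (allFin m)))
    ≡⟨ sum-concatMap (λ a → map (T′ a) (allFin m)) id (allFin m) ⟩
  sum (map (λ a → sum (map id (map (T′ a) (allFin m)))) (allFin m))
    ≡⟨ sum-map-cong (allFin m) (λ {a} _ → trans (cong sum (map-id (map (T′ a) (allFin m)))) (sum-map-cong (allFin m) (λ {b} _ →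
         cong (λ n → if bigger a b then n else 0) (maj a b)))) ⟩
  zStat r ∎
  where
  T′ : Fin m → Fin m → ℕ
  T′ a b = if bigger a b then MAJ (sub a b (reverse r)) else 0
  maj : ∀ a b → MAJ (sub a b (reverse r)) ≡ majd 0 (sub a b r)
  maj a b = begin
    MAJ (sub a b (reverse r))      ≡⟨ cong MAJ (filterᵇ-reverse _ r) ⟩
    MAJ (reverse (sub a b r))      ≡⟨ MAJ≡MAJd (reverse (sub a b r)) ⟩
    MAJd 1 (reverse (sub a b r))   ≡⟨ MAJd-reverse 0 (sub a b r) ⟩
    majd 0 (sub a b r)             ∎

sub-ˡ : ∀ {m} (a b : Fin m) r → sub a b (a ∷ r) ≡ a ∷ sub a b r
sub-ˡ a b r = filterᵇ-true _ (cong (_∨ eqL a b) (eqL-refl a)) r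

sub-ʳ : ∀ {m} (a b : Fin m) r → sub a b (b ∷ r) ≡ b ∷ sub a b r
sub-ʳ a b r = filterᵇ-true _ (trans (cong (eqL b a ∨_) (eqL-refl b)) (Bool.∨-zeroʳ (eqL b a))) r

sub-other : ∀ {m} {a b x : Fin m} → x ≢ a → x ≢ b → ∀ r → sub a b (x ∷ r) ≡ sub a b r
sub-other {a = a} {b} {x} x≢a x≢b r =
  filterᵇ-false (λ z → eqL z a ∨ eqL z b) {x} (cong₂ _∨_ (eqL-false {a = x} {a} x≢a) (eqL-false {a = x} {b} x≢b)) r

descent-max : ∀ {m} (x : Fin m) s → (∀ {z} → z ∈ s → toℕ z ≤ toℕ x) → descent x s ≡ 0
descent-max x [] _ = refl
descent-max x (y ∷ s) le = cong (if_then suc (length s) else 0) (<ᵇ-false (le (here refl)))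

zIncrement : ∀ {m} → Fin m → Fin m → Word m → ℕ
zIncrement x b r = if bigger x b then descent x (sub x b r) else 0

-- For a < b, an appended `b` is maximal in its two-letter subword and makes no descent, and a
-- letter other than `a` and `b` leaves the subword unchanged. So only x = a contributes.
zTerm-∷ : ∀ {m} (a b x : Fin m) r →
  zTerm a b (x ∷ r) ≡ (if eqL a x then zIncrement a b r else 0) + zTerm a b r
zTerm-∷ a b x r with a Fin.≟ x
zTerm-∷ a b .a r | yes refl = begin
  zTerm a b (a ∷ r)
    ≡⟨ cong (λ s → if bigger a b then majd 0 s else 0) (sub-ˡ a b r) ⟩
  (if bigger a b then descent a (sub a b r) + majd 0 (sub a b r) else 0)
    ≡⟨ if-+ (bigger a b) ⟩
  zIncrement a b r + zTerm a b r
    ≡⟨ cong (λ c → (if c then zIncrement a b r else 0) + zTerm a b r) (eqL-refl a) ⟨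
  (if eqL a a then zIncrement a b r else 0) + zTerm a b r ∎
  where
  if-+ : ∀ c {k l : ℕ} → (if c then k + l else 0) ≡ (if c then k else 0) + (if c then l else 0)
  if-+ true  = refl
  if-+ false = refl
zTerm-∷ a b x r | no a≢x = trans (go (x Fin.≟ b))
  (cong (λ c → (if c then zIncrement a b r else 0) + zTerm a b r) (sym (eqL-false {a = a} {x} a≢x)))
  where
  bound : toℕ a < toℕ b → ∀ {z} → z ∈ sub a b r → toℕ z ≤ toℕ b
  bound a<b {z} z∈ with bool-cases (eqL z a)
  ... | inj₁ e = ≤-trans (≤-reflexive (cong toℕ (eqL⇒≡ {a = z} {a} e))) (<⇒≤ a<b)
  ... | inj₂ e = ≤-reflexive (cong toℕ (eqL⇒≡ {a = z} {b}
    (trans (cong (_∨ eqL z b) (sym e)) (proj₂ (∈-filterᵇ⁻ (λ x → eqL x a ∨ eqL x b) {xs = r} z∈)))))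
  go : Dec (x ≡ b) → zTerm a b (x ∷ r) ≡ zTerm a b r
  go (no x≢b) = cong (λ s → if bigger a b then majd 0 s else 0) (sub-other (a≢x ∘ sym) x≢b r)
  go (yes refl) with bool-cases (bigger a b)
  ... | inj₂ e = trans (cong (if_then majd 0 (sub a b (b ∷ r)) else 0) e)
    (cong (if_then majd 0 (sub a b r) else 0) (sym e))
  ... | inj₁ e = cong (if bigger a b then_else 0) (trans (cong (majd 0) (sub-ʳ a b r))
    (cong (_+ majd 0 (sub a b r)) (descent-max b (sub a b r) (bound (bigger-true {x = a} {b} e)))))

zStat-[] : ∀ {m} → zStat {m} [] ≡ 0
zStat-[] {m} = sum-map-zero (allFin m) (λ a → sum-map-zero (allFin m) (λ b → lem (bigger a b)))
  where
  lem : ∀ c → (if c then 0 else 0) ≡ 0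
  lem true  = refl
  lem false = refl

zStat-∷ : ∀ {m} (x : Fin m) r → zStat (x ∷ r) ≡ ΣFin m (λ b → zIncrement x b r) + zStat r
zStat-∷ {m} x r = begin
  zStat (x ∷ r)
    ≡⟨ sum-map-cong (allFin m) (λ {a} _ → trans
         (sum-map-cong (allFin m) (λ {b} _ → zTerm-∷ a b x r))
         (trans (sum-map-+ (allFin m) (λ b → if eqL a x then zIncrement a b r else 0) (λ b → zTerm a b r))
           (cong (_+ ΣFin m (λ b → zTerm a b r)) (if-Σ (eqL a x) a)))) ⟩
  ΣFin m (λ a → (if eqL a x then ΣFin m (λ b → zIncrement a b r) else 0) + ΣFin m (λ b → zTerm a b r))
    ≡⟨ sum-map-+ (allFin m) (λ a → if eqL a x then ΣFin m (λ b → zIncrement a b r) else 0) _ ⟩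
  ΣFin m (λ a → if eqL a x then ΣFin m (λ b → zIncrement a b r) else 0) + zStat r
    ≡⟨ cong (_+ zStat r) (ΣFin-delta x (λ a → ΣFin m (λ b → zIncrement a b r))) ⟩
  ΣFin m (λ b → zIncrement x b r) + zStat r ∎
  where
  if-Σ : ∀ c a → ΣFin m (λ b → if c then zIncrement a b r else 0) ≡ (if c then ΣFin m (λ b → zIncrement a b r) else 0)
  if-Σ true  a = refl
  if-Σ false a = sum-map-zero (allFin m) (λ _ → refl)

-- Only letters b > x occurring after the last x (before it in the reversed
-- word) create a descent when x is appended, at position M + (copies of b).
zGain : ∀ {m} → Fin m → ℕ → Profile m → ℕ
zGain x M []            = 0
zGain x M ((b , κ) ∷ t) = if eqL x b then 0 else ((if bigger x b then M + suc κ else 0) + zGain x M t)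

zGain-here : ∀ {m} (x : Fin m) M κ t → zGain x M ((x , κ) ∷ t) ≡ 0
zGain-here x M κ t = cong (if_then 0 else ((if bigger x x then M + suc κ else 0) + zGain x M t)) (eqL-refl x)

zGain-there : ∀ {m} {x b : Fin m} → x ≢ b → ∀ M κ t →
  zGain x M ((b , κ) ∷ t) ≡ (if bigger x b then M + suc κ else 0) + zGain x M t
zGain-there {x = x} {b} ne M κ t = 
  cong (if_then 0 else ((if bigger x b then M + suc κ else 0) + zGain x M t)) (eqL-false {a = x} {b} ne)

length-sub : ∀ {m} {a b : Fin m} → a ≢ b → ∀ r → length (sub a b r) ≡ mult a r + mult b r
length-sub ne [] = refl
length-sub {a = a} {b} ne (x ∷ r) with x Fin.≟ a
... | yes refl = begin
  length (sub a b (a ∷ r))            ≡⟨ cong length (sub-ˡ a b r) ⟩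
  suc (length (sub a b r))            ≡⟨ cong suc (length-sub ne r) ⟩
  suc (mult a r) + mult b r           ≡⟨ cong₂ _+_ (mult-here a r) (mult-there (ne ∘ sym) r) ⟨
  mult a (a ∷ r) + mult b (a ∷ r)     ∎
... | no x≢a with x Fin.≟ b
...   | yes refl = begin
  length (sub a b (b ∷ r))            ≡⟨ cong length (sub-ʳ a b r) ⟩
  suc (length (sub a b r))            ≡⟨ cong suc (length-sub ne r) ⟩
  suc (mult a r + mult b r)           ≡⟨ +-suc (mult a r) (mult b r) ⟨
  mult a r + suc (mult b r)           ≡⟨ cong₂ _+_ (mult-there ne r) (mult-here b r) ⟨
  mult a (b ∷ r) + mult b (b ∷ r)     ∎
...   | no x≢b = begin
  length (sub a b (x ∷ r))            ≡⟨ cong length (sub-other x≢a x≢b r) ⟩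
  length (sub a b r)                  ≡⟨ length-sub ne r ⟩
  mult a r + mult b r                 ≡⟨ cong₂ _+_ (mult-there (x≢a ∘ sym) r) (mult-there (x≢b ∘ sym) r) ⟨
  mult a (x ∷ r) + mult b (x ∷ r)     ∎

zIncrement-same : ∀ {m} (x b : Fin m) r → zIncrement x b (x ∷ r) ≡ 0
zIncrement-same x b r = trans
  (cong (if bigger x b then_else 0) (trans (cong (descent x) (sub-ˡ x b r))
    (cong (if_then suc (length (sub x b r)) else 0) (<ᵇ-false {toℕ x} {toℕ x} ≤-refl))))
  (lem (bigger x b))
  where
  lem : ∀ c → (if c then 0 else 0) ≡ 0
  lem true  = refl
  lem false = refl

zIncrement-new : ∀ {m} {x y : Fin m} → x ≢ y → ∀ r →
  zIncrement x y (y ∷ r) ≡ (if bigger x y then mult x r + suc (mult y r) else 0)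
zIncrement-new {x = x} {y} ne r with bool-cases (bigger x y)
... | inj₁ e = cong (if bigger x y then_else 0) (begin
  descent x (sub x y (y ∷ r))       ≡⟨ cong (descent x) (sub-ʳ x y r) ⟩
  descent x (y ∷ sub x y r)         ≡⟨ cong (if_then suc (length (sub x y r)) else 0) e ⟩
  suc (length (sub x y r))          ≡⟨ cong suc (length-sub ne r) ⟩
  suc (mult x r + mult y r)         ≡⟨ +-suc (mult x r) (mult y r) ⟨
  mult x r + suc (mult y r)         ∎)
... | inj₂ e = trans (cong (if_then descent x (sub x y (y ∷ r)) else 0) e)
  (cong (if_then mult x r + suc (mult y r) else 0) (sym e))

-- A pair of `x` with `y` has its increment fixed by whichever of the two is met first. Restricting
-- the sum by `p` lets the induction drop a letter `y` already met, in step with `remove y` in the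
-- profile; `p` keeps `x`, whose entry ends the gain.
ΣzIncrement-filter : ∀ {m} (x : Fin m) (p : Fin m → Bool) → p x ≡ true → ∀ r →
  ΣFin m (λ b → if p b then zIncrement x b r else 0) ≡ zGain x (mult x r) (filterᵇ (p ∘ proj₁) (profile r))
ΣzIncrement-filter {m} x p px [] = sum-map-zero (allFin m) (λ b → lem (p b) (bigger x b))
  where
  lem : ∀ c d → (if c then (if d then 0 else 0) else 0) ≡ 0
  lem true  true  = refl
  lem true  false = refl
  lem false _     = refl
ΣzIncrement-filter {m} x p px (y ∷ r) with x Fin.≟ y
... | yes refl = begin
  ΣFin m (λ b → if p b then zIncrement x b (x ∷ r) else 0)
    ≡⟨ sum-map-zero (allFin m) (λ b → trans (cong (if p b then_else 0) (zIncrement-same x b r)) (lem (p b))) ⟩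
  0
    ≡⟨ zGain-here x M _ (filterᵇ (p ∘ proj₁) (remove x (profile r))) ⟨
  zGain x M ((x , copies x (profile r)) ∷ filterᵇ (p ∘ proj₁) (remove x (profile r)))
    ≡⟨ cong (zGain x M) (filterᵇ-true (p ∘ proj₁) px (remove x (profile r))) ⟨
  zGain x M (filterᵇ (p ∘ proj₁) (profile (x ∷ r))) ∎
  where
  M = mult x (x ∷ r)
  lem : ∀ c → (if c then 0 else 0) ≡ 0
  lem true  = refl
  lem false = refl
... | no x≢y = begin
  ΣFin m (λ b → if p b then zIncrement x b (y ∷ r) else 0)
    ≡⟨ sum-map-cong (allFin m) (λ {b} _ → split b) ⟩
  ΣFin m (λ b → (if eqL b y then new else 0) + old b)
    ≡⟨ sum-map-+ (allFin m) (λ b → if eqL b y then new else 0) old ⟩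
  ΣFin m (λ b → if eqL b y then new else 0) + ΣFin m old
    ≡⟨ cong₂ _+_ (ΣFin-delta y (λ _ → new)) (ΣzIncrement-filter x p′ p′x r) ⟩
  new + zGain x (mult x r) (filterᵇ (p′ ∘ proj₁) (profile r))
    ≡⟨ cong (λ t → new + zGain x (mult x r) t) (trans
         (filterᵇ-cong (λ e → ∧-comm (p (proj₁ e)) _) (profile r))
         (sym (filterᵇ-filterᵇ (p ∘ proj₁) _ (profile r)))) ⟩
  new + zGain x (mult x r) rest
    ≡⟨ collect ⟩
  zGain x (mult x r) (filterᵇ (p ∘ proj₁) (profile (y ∷ r)))
    ≡⟨ cong (λ M → zGain x M (filterᵇ (p ∘ proj₁) (profile (y ∷ r)))) (mult-there x≢y r) ⟨
  zGain x (mult x (y ∷ r)) (filterᵇ (p ∘ proj₁) (profile (y ∷ r))) ∎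
  where
  gain new : ℕ
  gain = if bigger x y then mult x r + suc (mult y r) else 0
  new = if p y then gain else 0
  p′ : Fin m → Bool
  p′ b = p b ∧ not (eqL y b)
  old : Fin m → ℕ
  old b = if p′ b then zIncrement x b r else 0
  rest : Profile m
  rest = filterᵇ (p ∘ proj₁) (remove y (profile r))
  p′x : p′ x ≡ true
  p′x = cong₂ (λ b c → b ∧ not c) px (eqL-false {a = y} {x} (x≢y ∘ sym))
  split : ∀ b → (if p b then zIncrement x b (y ∷ r) else 0) ≡ (if eqL b y then new else 0) + old b
  split b with b Fin.≟ y
  ... | yes refl = begin
    (if p y then zIncrement x y (y ∷ r) else 0)
      ≡⟨ cong (if p y then_else 0) (zIncrement-new x≢y r) ⟩
    new
      ≡⟨ +-identityʳ new ⟨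
    new + 0
      ≡⟨ cong₂ (λ c d → (if c then new else 0) + (if d then zIncrement x y r else 0))
           (eqL-refl y) (trans (cong (λ c → p y ∧ not c) (eqL-refl y)) (∧-zeroʳ (p y))) ⟨
    (if eqL y y then new else 0) + old y ∎
  ... | no b≢y = begin
    (if p b then zIncrement x b (y ∷ r) else 0)
      ≡⟨ cong (λ s → if p b then (if bigger x b then descent x s else 0) else 0)
           (sub-other (x≢y ∘ sym) (b≢y ∘ sym) r) ⟩
    (if p b then zIncrement x b r else 0)
      ≡⟨ cong₂ (λ c d → (if c then new else 0) + (if d then zIncrement x b r else 0))
           (eqL-false {a = b} {y} b≢y)
           (trans (cong (λ c → p b ∧ not c) (eqL-false {a = y} {b} (b≢y ∘ sym))) (Bool.∧-identityʳ (p b))) ⟨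
    (if eqL b y then new else 0) + old b ∎
  collect : new + zGain x (mult x r) rest ≡ zGain x (mult x r) (filterᵇ (p ∘ proj₁) (profile (y ∷ r)))
  collect with bool-cases (p y)
  ... | inj₁ py = begin
    new + zGain x (mult x r) rest
      ≡⟨ cong (λ c → (if c then gain else 0) + zGain x (mult x r) rest) py ⟩
    gain + zGain x (mult x r) rest
      ≡⟨ cong (λ n → (if bigger x y then mult x r + suc n else 0) + zGain x (mult x r) rest) (copies-profile y r) ⟨
    (if bigger x y then mult x r + suc (copies y (profile r)) else 0) + zGain x (mult x r) rest
      ≡⟨ zGain-there x≢y (mult x r) (copies y (profile r)) rest ⟨
    zGain x (mult x r) ((y , copies y (profile r)) ∷ rest)
      ≡⟨ cong (zGain x (mult x r)) (filterᵇ-true (p ∘ proj₁) py (remove y (profile r))) ⟨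
    zGain x (mult x r) (filterᵇ (p ∘ proj₁) (profile (y ∷ r))) ∎
  ... | inj₂ py = begin
    new + zGain x (mult x r) rest
      ≡⟨ cong (λ c → (if c then gain else 0) + zGain x (mult x r) rest) py ⟩
    zGain x (mult x r) rest
      ≡⟨ cong (zGain x (mult x r)) (filterᵇ-false (p ∘ proj₁) py (remove y (profile r))) ⟨
    zGain x (mult x r) (filterᵇ (p ∘ proj₁) (profile (y ∷ r))) ∎

zStat-profile : ∀ {m} (x : Fin m) r → zStat (x ∷ r) ≡ zGain x (copies x (profile r)) (profile r) + zStat r
zStat-profile {m} x r = trans (zStat-∷ x r) (cong (_+ zStat r) (begin
  ΣFin m (λ b → zIncrement x b r)
    ≡⟨ ΣzIncrement-filter x (λ _ → true) refl r ⟩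
  zGain x (mult x r) (filterᵇ (λ _ → true) (profile r))
    ≡⟨ cong₂ (zGain x) (sym (copies-profile x r)) (filterᵇ-id _ (profile r) (λ _ → refl)) ⟩
  zGain x (copies x (profile r)) (profile r) ∎))

-- The common generating function

upper : ∀ {m} → Fin m → Profile m → ℕ
upper a t = sum (map (λ e → if bigger a (proj₁ e) then suc (proj₂ e) else 0) t)

zGain-∉ : ∀ {m} {a : Fin m} t → a ∉ keys t → zGain a 0 t ≡ upper a t
zGain-∉ [] _ = refl
zGain-∉ {a = a} ((b , κ) ∷ t) a∉ = trans (zGain-there (λ { refl → a∉ (here refl) }) 0 κ t)
  (cong ((if bigger a b then suc κ else 0) +_) (zGain-∉ t (a∉ ∘ there)))

weight-insertions : ∀ {m} (a : Fin m) κ t {s} → s ∈ insertions (a , κ) t → weight s ≡ suc κ + weight t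
weight-insertions a κ t s∈ = sum-↭ (map⁺ (suc ∘ proj₂) (insertions-↭ (a , κ) t s∈))

upper-insertions : ∀ {m} (c a : Fin m) κ t {s} → s ∈ insertions (a , κ) t →
  upper c s ≡ (if bigger c a then suc κ else 0) + upper c t
upper-insertions c a κ t s∈ = sum-↭ (map⁺ _ (insertions-↭ (a , κ) t s∈))

length-shuffles : ∀ {m} (a : Fin m) κ w {v} → v ∈ shuffles a κ w → length v ≡ κ + length w
length-shuffles a zero w (here refl) = refl
length-shuffles a (suc κ) [] v∈ with u , u∈ , refl ← ∈-map⁻ (a ∷_) v∈ = cong suc (length-shuffles a κ [] u∈)
length-shuffles a (suc κ) (x ∷ w) v∈ with ∈-++⁻ (map (a ∷_) (shuffles a κ (x ∷ w))) v∈
... | inj₁ p with u , u∈ , refl ← ∈-map⁻ (a ∷_) p = cong suc (length-shuffles a κ (x ∷ w) u∈)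
... | inj₂ p with u , u∈ , refl ← ∈-map⁻ (x ∷_) p =
  cong suc (trans (length-shuffles a (suc κ) w u∈) (sym (+-suc κ (length w))))

countᵇ-shuffles : ∀ {m} (p : Fin m → Bool) (a : Fin m) κ w {v} → v ∈ shuffles a κ w →
  countᵇ p v ≡ κ * ind (p a) + countᵇ p w
countᵇ-shuffles p a zero w (here refl) = refl
countᵇ-shuffles p a (suc κ) w v∈ = go w v∈
  where
  via-a : ∀ w {v} → v ∈ map (a ∷_) (shuffles a κ w) → countᵇ p v ≡ suc κ * ind (p a) + countᵇ p w
  via-a w v∈ with u , u∈ , refl ← ∈-map⁻ (a ∷_) v∈ = begin
    countᵇ p (a ∷ u)                             ≡⟨ countᵇ-∷ p a u ⟩
    ind (p a) + countᵇ p u                       ≡⟨ cong (ind (p a) +_) (countᵇ-shuffles p a κ w u∈) ⟩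
    ind (p a) + (κ * ind (p a) + countᵇ p w)     ≡⟨ +-assoc (ind (p a)) _ _ ⟨
    suc κ * ind (p a) + countᵇ p w               ∎
  go : ∀ w {v} → v ∈ shuffles a (suc κ) w → countᵇ p v ≡ suc κ * ind (p a) + countᵇ p w
  go [] v∈ = via-a [] v∈
  go (x ∷ w) v∈ with ∈-++⁻ (map (a ∷_) (shuffles a κ (x ∷ w))) v∈
  ... | inj₁ q = via-a (x ∷ w) q
  ... | inj₂ q with u , u∈ , refl ← ∈-map⁻ (x ∷_) q = begin
    countᵇ p (x ∷ u)                                 ≡⟨ countᵇ-∷ p x u ⟩
    ind (p x) + countᵇ p u                           ≡⟨ cong (ind (p x) +_) (go w u∈) ⟩
    ind (p x) + (suc κ * ind (p a) + countᵇ p w)     ≡⟨ lem (ind (p x)) (suc κ * ind (p a)) (countᵇ p w) ⟩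
    suc κ * ind (p a) + (ind (p x) + countᵇ p w)     ≡⟨ cong (suc κ * ind (p a) +_) (countᵇ-∷ p x w) ⟨
    suc κ * ind (p a) + countᵇ p (x ∷ w)             ∎
    where
    lem : ∀ a b c → a + (b + c) ≡ b + (a + c)
    lem = solve-∀

countᵇ-all : {A : Set} (p : A → Bool) → ∀ xs → (∀ {z} → z ∈ xs → p z ≡ true) → countᵇ p xs ≡ length xs
countᵇ-all p xs all = cong length (filterᵇ-id p xs all)

countᵇ-none : {A : Set} (p : A → Bool) → ∀ xs → (∀ {z} → z ∈ xs → p z ≡ false) → countᵇ p xs ≡ 0
countᵇ-none p [] _ = refl
countᵇ-none p (x ∷ xs) none = trans (countᵇ-∷ p x xs)
  (cong₂ (λ b n → ind b + n) (none (here refl)) (countᵇ-none p xs (none ∘ there)))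

length-shuffleWords : ∀ {m} (t : Profile m) {w} → w ∈ shuffleWords t → length w ≡ weight t
length-shuffleWords [] (here refl) = refl
length-shuffleWords ((a , κ) ∷ t) w∈
  with u , u∈ , p ← find (∈-concatMap⁻ (λ w → map (a ∷_) (shuffles a κ w)) {shuffleWords t} w∈)
  with v , v∈ , refl ← ∈-map⁻ (a ∷_) p =
  cong suc (trans (length-shuffles a κ u v∈) (cong (κ +_) (length-shuffleWords t u∈)))

-- As `a` lies outside the interval formed by `β`, its comparison with a single letter of `β`
-- decides all comparisons.
extreme : ∀ {m} {a : Fin m} β → a ∉ β → ConvexTails β →
  (∀ {b} → b ∈ β → toℕ a < toℕ b) ⊎ (∀ {b} → b ∈ β → toℕ b < toℕ a)
extreme [] _ _ = inj₁ λ ()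
extreme {a = a} β@(b ∷ _) a∉ (conv , _) with <-cmp (toℕ a) (toℕ b)
... | tri≈ _ eq _ = contradiction (here (Fin.toℕ-injective eq)) a∉
... | tri< a<b _ _ = inj₁ λ {c} c∈ → ≰⇒> (λ c≤a →
  a∉ (member⇒∈ β (conv {c} {a} {b} (member-true c∈) (member-true {β = β} (here refl)) c≤a (<⇒≤ a<b))))
... | tri> _ _ b<a = inj₂ λ {c} c∈ → ≰⇒> (λ a≤c →
  a∉ (member⇒∈ β (conv {b} {a} {c} (member-true {β = β} (here refl)) (member-true c∈) (<⇒≤ b<a) a≤c)))

module GeneratingFunction (q : ℕ) where

  open QBinomial q

  gf : {A : Set} → (A → ℕ) → List A → ℕ
  gf f xs = sum (map (λ x → q ^ f x) xs)

  gf-++ : {A : Set} (f : A → ℕ) (xs ys : List A) → gf f (xs ++ ys) ≡ gf f xs + gf f ys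
  gf-++ f xs ys = trans (cong sum (map-++ _ xs ys)) (sum-++ (map (λ x → q ^ f x) xs) _)

  gf-map : {A : Set} (f : A → ℕ) (g : A → A) (e : ℕ) (xs : List A) →
    (∀ {x} → x ∈ xs → f (g x) ≡ e + f x) → gf f (map g xs) ≡ q ^ e * gf f xs
  gf-map f g e xs eq = begin
    sum (map (λ x → q ^ f x) (map g xs))   ≡⟨ cong sum (map-∘ xs) ⟨
    sum (map (λ x → q ^ f (g x)) xs)
      ≡⟨ sum-map-cong xs (λ x∈ → trans (cong (q ^_) (eq x∈)) (^-distribˡ-+-* q e _)) ⟩
    sum (map (λ x → q ^ e * q ^ f x) xs)   ≡⟨ sum-map-* xs (q ^ e) _ ⟩
    q ^ e * gf f xs                        ∎

  -- For a = τ_i one has κ = k_a - 1 and `weight t` = s_{i-1}, so `binom κ (weight t)` is the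
  -- q-binomial of s_i - 1 over k_a - 1; the exponents `upper a t` add up to η.
  classGF : ∀ {m} → Profile m → ℕ
  classGF []            = 1
  classGF ((a , κ) ∷ t) = q ^ upper a t * (binom κ (weight t) * classGF t)

  binom-zeroʳ : ∀ a → binom a 0 ≡ 1
  binom-zeroʳ zero    = refl
  binom-zeroʳ (suc a) = refl

  -- Split by whether `a` is inserted before or after the first key `c`. Before it, the gain is 0
  -- and the factor is `binom κ W`. After it, the factors due to `c` come out, induction applies to
  -- `t′`, and the trinomial identity interchanges the choices for `c` and `a`.
  classGF-insertions : ∀ {m} (a : Fin m) κ t → a ∉ keys t →
    sum (map (λ s → q ^ zGain a (suc κ) s * classGF s) (insertions (a , κ) t)) ≡
    q ^ upper a t * (binom (suc κ) (weight t) * classGF t)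
  classGF-insertions a κ [] _ = begin
    q ^ zGain a (suc κ) ((a , κ) ∷ []) * (1 * (binom κ 0 * 1)) + 0
      ≡⟨ cong₂ (λ e b → q ^ e * (1 * (b * 1)) + 0) (zGain-here a (suc κ) κ []) (binom-zeroʳ κ) ⟩
    1 ∎
  classGF-insertions {m} a κ t@((c , l) ∷ t′) a∉ = begin
    F ((a , κ) ∷ t) + sum (map F (map ((c , l) ∷_) (insertions (a , κ) t′)))
      ≡⟨ cong₂ _+_ first rest ⟩
    q ^ u * (binom κ W * P) + q ^ u * (q ^ suc κ * binom (suc κ) (l + w′) * P)
      -- `W` computes to `suc (l + w′)`, so the bracketed sum is `binom (suc κ) W` by the defining
      -- q-Pascal rule.
      ≡⟨ lem₁ (q ^ u) (binom κ W) (q ^ suc κ * binom (suc κ) (l + w′)) P ⟩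
    q ^ u * (binom (suc κ) W * P) ∎
    where
    F : Profile m → ℕ
    F s = q ^ zGain a (suc κ) s * classGF s
    a≢c : a ≢ c
    a≢c refl = a∉ (here refl)
    u u′ v′ w′ W P P′ A B C : ℕ
    u = upper a t
    u′ = upper a t′
    v′ = upper c t′
    w′ = weight t′
    W = weight t
    P = classGF t
    P′ = classGF t′
    A = if bigger a c then suc κ + suc l else 0
    B = if bigger a c then suc l else 0
    C = if bigger c a then suc κ else 0
    lem₁ : ∀ x b d p → x * (b * p) + x * (d * p) ≡ x * ((b + d) * p)
    lem₁ = solve-∀
    first : F ((a , κ) ∷ t) ≡ q ^ u * (binom κ W * P)
    first = trans (cong (λ e → q ^ e * classGF ((a , κ) ∷ t)) (zGain-here a (suc κ) κ t)) (+-identityʳ _)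
    K : ℕ
    K = q ^ A * (q ^ (C + v′) * binom l (suc κ + w′))
    pull : ∀ {s} → s ∈ insertions (a , κ) t′ → F ((c , l) ∷ s) ≡ K * F s
    pull {s} s∈ = begin
      q ^ zGain a (suc κ) ((c , l) ∷ s) * (q ^ upper c s * (binom l (weight s) * classGF s))
        ≡⟨ cong₂ (λ e r → q ^ e * r) (zGain-there a≢c (suc κ) l s)
             (cong₂ (λ e n → q ^ e * (binom l n * classGF s)) (upper-insertions c a κ t′ s∈) (weight-insertions a κ t′ s∈)) ⟩
      q ^ (A + zGain a (suc κ) s) * (q ^ (C + v′) * (binom l (suc κ + w′) * classGF s))
        ≡⟨ cong (_* (q ^ (C + v′) * (binom l (suc κ + w′) * classGF s))) (^-distribˡ-+-* q A (zGain a (suc κ) s)) ⟩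
      q ^ A * q ^ zGain a (suc κ) s * (q ^ (C + v′) * (binom l (suc κ + w′) * classGF s))
        ≡⟨ lem (q ^ A) (q ^ zGain a (suc κ) s) (q ^ (C + v′)) (binom l (suc κ + w′)) (classGF s) ⟩
      K * F s ∎
      where
      lem : ∀ x y z b p → x * y * (z * (b * p)) ≡ x * (z * b) * (y * p)
      lem = solve-∀
    -- The remaining copies of `a` are counted exactly once: in the gain of `a` if a < c, in the
    -- exponent of `c` if c < a. Hence the factor `q ^ suc κ` whatever the order of the two letters.
    exponents : A + C ≡ B + suc κ
    exponents with <-cmp (toℕ a) (toℕ c)
    ... | tri≈ _ eq _ = contradiction (Fin.toℕ-injective eq) a≢c
    ... | tri< a<c _ _ = begin
      A + C
        ≡⟨ cong₂ (λ b d → (if b then suc κ + suc l else 0) + (if d then suc κ else 0)) (<ᵇ-true a<c) (<ᵇ-false (<⇒≤ a<c)) ⟩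
      suc κ + suc l + 0
        ≡⟨ trans (+-identityʳ _) (+-comm (suc κ) (suc l)) ⟩
      suc l + suc κ
        ≡⟨ cong (λ b → (if b then suc l else 0) + suc κ) (<ᵇ-true a<c) ⟨
      B + suc κ ∎
    ... | tri> _ _ c<a = trans
      (cong₂ (λ b d → (if b then suc κ + suc l else 0) + (if d then suc κ else 0)) (<ᵇ-false (<⇒≤ c<a)) (<ᵇ-true c<a))
      (cong (λ b → (if b then suc l else 0) + suc κ) (sym (<ᵇ-false (<⇒≤ c<a))))
    powers : q ^ A * q ^ (C + v′) * q ^ u′ ≡ q ^ u * q ^ suc κ * q ^ v′
    powers = begin
      q ^ A * q ^ (C + v′) * q ^ u′
        ≡⟨ trans (cong (_* q ^ u′) (sym (^-distribˡ-+-* q A (C + v′)))) (sym (^-distribˡ-+-* q (A + (C + v′)) u′)) ⟩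
      q ^ (A + (C + v′) + u′)
        ≡⟨ cong (q ^_) (trans (re₁ A C v′ u′) (trans (cong (λ e → e + v′ + u′) exponents) (re₂ B (suc κ) v′ u′))) ⟩
      q ^ (B + u′ + suc κ + v′)
        ≡⟨ trans (^-distribˡ-+-* q (u + suc κ) v′) (cong (_* q ^ v′) (^-distribˡ-+-* q u (suc κ))) ⟩
      q ^ u * q ^ suc κ * q ^ v′ ∎
      where
      re₁ : ∀ a c v u → a + (c + v) + u ≡ a + c + v + u
      re₁ = solve-∀
      re₂ : ∀ b k v u → b + k + v + u ≡ b + u + k + v
      re₂ = solve-∀
    rest : sum (map F (map ((c , l) ∷_) (insertions (a , κ) t′))) ≡
      q ^ u * (q ^ suc κ * binom (suc κ) (l + w′) * P)
    rest = begin
      sum (map F (map ((c , l) ∷_) (insertions (a , κ) t′)))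
        ≡⟨ cong sum (map-∘ (insertions (a , κ) t′)) ⟨
      sum (map (λ s → F ((c , l) ∷ s)) (insertions (a , κ) t′))
        ≡⟨ sum-map-cong (insertions (a , κ) t′) pull ⟩
      sum (map (λ s → K * F s) (insertions (a , κ) t′))
        ≡⟨ sum-map-* (insertions (a , κ) t′) K F ⟩
      K * sum (map F (insertions (a , κ) t′))
        ≡⟨ cong (K *_) (classGF-insertions a κ t′ (a∉ ∘ there)) ⟩
      K * (q ^ u′ * (binom (suc κ) w′ * P′))
        ≡⟨ lem₂ (q ^ A) (q ^ (C + v′)) (binom l (suc κ + w′)) (q ^ u′) (binom (suc κ) w′) P′ ⟩
      q ^ A * q ^ (C + v′) * q ^ u′ * (binom l (suc κ + w′) * binom (suc κ) w′) * P′
        ≡⟨ cong₂ (λ x y → x * y * P′) powers (binom-trinomial l (suc κ) w′) ⟩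
      q ^ u * q ^ suc κ * q ^ v′ * (binom (suc κ) (l + w′) * binom l w′) * P′
        ≡⟨ lem₃ (q ^ u) (q ^ suc κ) (q ^ v′) (binom (suc κ) (l + w′)) (binom l w′) P′ ⟩
      q ^ u * (q ^ suc κ * binom (suc κ) (l + w′) * P) ∎
      where
      lem₂ : ∀ x y b z d p → x * (y * b) * (z * (d * p)) ≡ x * y * z * (b * d) * p
      lem₂ = solve-∀
      lem₃ : ∀ x y z b d p → x * y * z * (b * d) * p ≡ x * (y * b * (z * (d * p)))
      lem₃ = solve-∀

  -- The gain of the last letter depends only on the profile of the rest and so is constant on each
  -- branch of `words`; every branch contributes a power of q times the value for its own profile.
  gf-zStat : ∀ {m} n (t : Profile m) → weight t ≡ n → Unique (keys t) → gf zStat (words n t) ≡ classGF t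
  gf-zStat {m} zero [] _ _ = cong (λ e → q ^ e + 0) (zStat-[] {m})
  gf-zStat (suc n) ((a , zero) ∷ t) wt (a# ∷ u) = begin
    gf zStat (map (a ∷_) (words n t))
      ≡⟨ gf-map zStat (a ∷_) (upper a t) (words n t) step ⟩
    q ^ upper a t * gf zStat (words n t)
      ≡⟨ cong (q ^ upper a t *_) (trans (gf-zStat n t (suc-injective wt) u) (sym (+-identityʳ _))) ⟩
    q ^ upper a t * (1 * classGF t) ∎
    where
    step : ∀ {s} → s ∈ words n t → zStat (a ∷ s) ≡ upper a t + zStat s
    step {s} s∈ with refl , _ ← words-sound n t u s∈ = trans (zStat-profile a s) (cong (_+ zStat s) (trans
      (cong (λ M → zGain a M (profile s)) (copies-∉ (profile s) (All¬⇒¬Any a#)))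
      (zGain-∉ (profile s) (All¬⇒¬Any a#))))
  gf-zStat (suc n) ((a , suc κ) ∷ t) wt u@(a# ∷ _) = begin
    gf zStat (map (a ∷_) (concatMap (words n) I))
      ≡⟨ cong (gf zStat) (map-concatMap (a ∷_) (words n) I) ⟩
    gf zStat (concatMap (λ s → map (a ∷_) (words n s)) I)
      ≡⟨ sum-concatMap (λ s → map (a ∷_) (words n s)) (λ r → q ^ zStat r) I ⟩
    sum (map (λ s → gf zStat (map (a ∷_) (words n s))) I)
      ≡⟨ sum-map-cong I step ⟩
    sum (map (λ s → q ^ zGain a (suc κ) s * classGF s) I)
      ≡⟨ classGF-insertions a κ t (All¬⇒¬Any a#) ⟩
    q ^ upper a t * (binom (suc κ) (weight t) * classGF t) ∎
    where
    I = insertions (a , κ) t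
    step : ∀ {s} → s ∈ I → gf zStat (map (a ∷_) (words n s)) ≡ q ^ zGain a (suc κ) s * classGF s
    step {s} s∈ = trans
      (gf-map zStat (a ∷_) (zGain a (suc κ) s) (words n s) gain)
      (cong (q ^ zGain a (suc κ) s *_)
        (gf-zStat n s (trans (weight-insertions a κ t s∈) (suc-injective wt)) (keys-insertions t u s∈)))
      where
      gain : ∀ {r} → r ∈ words n s → zStat (a ∷ r) ≡ zGain a (suc κ) s + zStat r
      gain {r} r∈ with refl , _ ← words-sound n s (keys-insertions t u s∈) r∈ =
        trans (zStat-profile a r) (cong (λ M → zGain a M (profile r) + zStat r)
          (proj₁ (remove-insertions t (All¬⇒¬Any a#) s∈)))

  -- A leading `a` is inverted with every letter of `x ∷ w`, while a leading `x` is inverted with no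
  -- `a`. This is the q-Pascal rule with its weight on the branch of `a`, `binom-pascalʳ`.
  gf-shuffles-min : ∀ {m} (a : Fin m) κ w → (∀ {b} → b ∈ w → toℕ a < toℕ b) →
    gf inv (shuffles a κ w) ≡ binom κ (length w) * q ^ inv w
  gf-shuffles-min a zero w _ = refl
  gf-shuffles-min a (suc κ) [] min = begin
    gf inv (map (a ∷_) (shuffles a κ []))
      ≡⟨ gf-map inv (a ∷_) 0 (shuffles a κ []) (λ {v} v∈ → cong (_+ inv v)
           (trans (countᵇ-shuffles (bigger a) a κ [] v∈)
             (trans (+-identityʳ _) (trans (cong (λ b → κ * ind b) (<ᵇ-false {toℕ a} ≤-refl)) (*-zeroʳ κ))))) ⟩
    1 * gf inv (shuffles a κ [])
      ≡⟨ +-identityʳ _ ⟩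
    gf inv (shuffles a κ [])
      ≡⟨ gf-shuffles-min a κ [] min ⟩
    binom κ 0 * 1
      ≡⟨ cong (_* 1) (binom-zeroʳ κ) ⟩
    1 ∎
  gf-shuffles-min a (suc κ) (x ∷ w) min = begin
    gf inv (map (a ∷_) (shuffles a κ (x ∷ w)) ++ map (x ∷_) (shuffles a (suc κ) w))
      ≡⟨ gf-++ inv (map (a ∷_) (shuffles a κ (x ∷ w))) _ ⟩
    gf inv (map (a ∷_) (shuffles a κ (x ∷ w))) + gf inv (map (x ∷_) (shuffles a (suc κ) w))
      ≡⟨ cong₂ _+_
           (gf-map inv (a ∷_) (suc (length w)) (shuffles a κ (x ∷ w)) (λ {v} v∈ → cong (_+ inv v) (above-a v∈)))
           (gf-map inv (x ∷_) (above x w) (shuffles a (suc κ) w) (λ {v} v∈ → cong (_+ inv v) (above-x v∈))) ⟩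
    q ^ suc (length w) * gf inv (shuffles a κ (x ∷ w)) + q ^ above x w * gf inv (shuffles a (suc κ) w)
      ≡⟨ cong₂ (λ f g → q ^ suc (length w) * f + q ^ above x w * g)
           (gf-shuffles-min a κ (x ∷ w) min) (gf-shuffles-min a (suc κ) w (min ∘ there)) ⟩
    q ^ suc (length w) * (binom κ (suc (length w)) * q ^ (above x w + inv w)) + q ^ above x w * (binom (suc κ) (length w) * q ^ inv w)
      ≡⟨ cong (λ f → q ^ suc (length w) * (binom κ (suc (length w)) * f) + q ^ above x w * (binom (suc κ) (length w) * q ^ inv w))
           (^-distribˡ-+-* q (above x w) (inv w)) ⟩
    q ^ suc (length w) * (binom κ (suc (length w)) * (q ^ above x w * q ^ inv w)) + q ^ above x w * (binom (suc κ) (length w) * q ^ inv w)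
      ≡⟨ lem (q ^ suc (length w)) (binom κ (suc (length w))) (q ^ above x w) (q ^ inv w) (binom (suc κ) (length w)) ⟩
    (q ^ suc (length w) * binom κ (suc (length w)) + binom (suc κ) (length w)) * (q ^ above x w * q ^ inv w)
      ≡⟨ cong₂ _*_ (sym (binom-pascalʳ κ (length w))) (sym (^-distribˡ-+-* q (above x w) (inv w))) ⟩
    binom (suc κ) (suc (length w)) * q ^ inv (x ∷ w) ∎
    where
    above-a : ∀ {v} → v ∈ shuffles a κ (x ∷ w) → above a v ≡ suc (length w)
    above-a v∈ = trans (countᵇ-shuffles (bigger a) a κ (x ∷ w) v∈)
      (cong₂ _+_ (trans (cong (λ b → κ * ind b) (<ᵇ-false {toℕ a} ≤-refl)) (*-zeroʳ κ))
                 (countᵇ-all (bigger a) (x ∷ w) (<ᵇ-true ∘ min)))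
    above-x : ∀ {v} → v ∈ shuffles a (suc κ) w → above x v ≡ above x w
    above-x v∈ = trans (countᵇ-shuffles (bigger x) a (suc κ) w v∈)
      (cong (_+ above x w) (trans (cong (λ b → suc κ * ind b) (<ᵇ-false (<⇒≤ (min (here refl))))) (*-zeroʳ κ)))
    lem : ∀ p b y z d → p * (b * (y * z)) + y * (d * z) ≡ (p * b + d) * (y * z)
    lem = solve-∀

  -- Now a leading `a` costs nothing and a leading `x` is inverted with all `suc κ` copies of `a`,
  -- so the defining q-Pascal rule yields the same coefficient.
  gf-shuffles-max : ∀ {m} (a : Fin m) κ w → (∀ {b} → b ∈ w → toℕ b < toℕ a) →
    gf inv (shuffles a κ w) ≡ binom κ (length w) * q ^ inv w
  gf-shuffles-max a zero w _ = refl
  gf-shuffles-max a (suc κ) [] _ = gf-shuffles-min a (suc κ) [] (λ ())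
  gf-shuffles-max a (suc κ) (x ∷ w) max = begin
    gf inv (map (a ∷_) (shuffles a κ (x ∷ w)) ++ map (x ∷_) (shuffles a (suc κ) w))
      ≡⟨ gf-++ inv (map (a ∷_) (shuffles a κ (x ∷ w))) _ ⟩
    gf inv (map (a ∷_) (shuffles a κ (x ∷ w))) + gf inv (map (x ∷_) (shuffles a (suc κ) w))
      ≡⟨ cong₂ _+_
           (gf-map inv (a ∷_) 0 (shuffles a κ (x ∷ w)) (λ {v} v∈ → cong (_+ inv v) (above-a v∈)))
           (gf-map inv (x ∷_) (suc κ + above x w) (shuffles a (suc κ) w) (λ {v} v∈ → cong (_+ inv v) (above-x v∈))) ⟩
    1 * gf inv (shuffles a κ (x ∷ w)) + q ^ (suc κ + above x w) * gf inv (shuffles a (suc κ) w)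
      ≡⟨ cong₂ (λ f g → 1 * f + q ^ (suc κ + above x w) * g)
           (gf-shuffles-max a κ (x ∷ w) max) (gf-shuffles-max a (suc κ) w (max ∘ there)) ⟩
    1 * (binom κ (suc (length w)) * q ^ (above x w + inv w)) + q ^ (suc κ + above x w) * (binom (suc κ) (length w) * q ^ inv w)
      ≡⟨ cong₂ (λ f g → 1 * (binom κ (suc (length w)) * f) + g * (binom (suc κ) (length w) * q ^ inv w))
           (^-distribˡ-+-* q (above x w) (inv w)) (^-distribˡ-+-* q (suc κ) (above x w)) ⟩
    1 * (binom κ (suc (length w)) * (q ^ above x w * q ^ inv w)) + q ^ suc κ * q ^ above x w * (binom (suc κ) (length w) * q ^ inv w)
      ≡⟨ lem (q ^ suc κ) (binom κ (suc (length w))) (q ^ above x w) (q ^ inv w) (binom (suc κ) (length w)) ⟩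
    binom (suc κ) (suc (length w)) * (q ^ above x w * q ^ inv w)
      ≡⟨ cong (binom (suc κ) (suc (length w)) *_) (^-distribˡ-+-* q (above x w) (inv w)) ⟨
    binom (suc κ) (suc (length w)) * q ^ inv (x ∷ w) ∎
    where
    above-a : ∀ {v} → v ∈ shuffles a κ (x ∷ w) → above a v ≡ 0
    above-a v∈ = trans (countᵇ-shuffles (bigger a) a κ (x ∷ w) v∈)
      (cong₂ _+_ (trans (cong (λ b → κ * ind b) (<ᵇ-false {toℕ a} ≤-refl)) (*-zeroʳ κ))
                 (countᵇ-none (bigger a) (x ∷ w) (<ᵇ-false ∘ <⇒≤ ∘ max)))
    above-x : ∀ {v} → v ∈ shuffles a (suc κ) w → above x v ≡ suc κ + above x w
    above-x v∈ = trans (countᵇ-shuffles (bigger x) a (suc κ) w v∈)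
      (cong (_+ above x w) (trans (cong (λ b → suc κ * ind b) (<ᵇ-true (max (here refl)))) (*-identityʳ (suc κ))))
    lem : ∀ p b y z d → 1 * (b * (y * z)) + p * y * (d * z) ≡ (b + p * d) * (y * z)
    lem = solve-∀

  gf-inv : ∀ {m} (t : Profile m) → Unique (keys t) → ConvexTails (keys t) →
    gf inv (shuffleWords t) ≡ classGF t
  gf-inv [] _ _ = refl
  gf-inv ((a , κ) ∷ t) (a# ∷ u) (_ , convs) = begin
    gf inv (concatMap (λ w → map (a ∷_) (shuffles a κ w)) (shuffleWords t))
      ≡⟨ sum-concatMap (λ w → map (a ∷_) (shuffles a κ w)) (λ r → q ^ inv r) (shuffleWords t) ⟩
    sum (map (λ w → gf inv (map (a ∷_) (shuffles a κ w))) (shuffleWords t))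
      ≡⟨ sum-map-cong (shuffleWords t) step ⟩
    sum (map (λ w → q ^ upper a t * binom κ (weight t) * q ^ inv w) (shuffleWords t))
      ≡⟨ sum-map-* (shuffleWords t) (q ^ upper a t * binom κ (weight t)) (λ w → q ^ inv w) ⟩
    q ^ upper a t * binom κ (weight t) * gf inv (shuffleWords t)
      ≡⟨ cong (q ^ upper a t * binom κ (weight t) *_) (gf-inv t u convs) ⟩
    q ^ upper a t * binom κ (weight t) * classGF t
      ≡⟨ *-assoc (q ^ upper a t) _ _ ⟩
    q ^ upper a t * (binom κ (weight t) * classGF t) ∎
    where
    a∉ : a ∉ keys t
    a∉ = All¬⇒¬Any a#
    letters : ∀ {w} → w ∈ shuffleWords t → ∀ {b} → b ∈ w → b ∈ keys t
    letters {w} w∈ b∈ = subst (_ ∈_)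
      (trans (sym (keys-profile w)) (cong keys (shuffleWords-sound t u w∈))) (∈-order⁺ w b∈)
    -- `e` counts the inversions of the final `a`: all of `w` when `a` is minimal, none when it is
    -- maximal. Both values agree with `upper a t`.
    finish : ∀ w e → length w ≡ weight t → upper a t ≡ e →
      gf inv (shuffles a κ w) ≡ binom κ (length w) * q ^ inv w →
      (∀ {v} → v ∈ shuffles a κ w → above a v ≡ e) →
      gf inv (map (a ∷_) (shuffles a κ w)) ≡ q ^ upper a t * binom κ (weight t) * q ^ inv w
    finish w e len up sh ab = begin
      gf inv (map (a ∷_) (shuffles a κ w))
        ≡⟨ gf-map inv (a ∷_) e (shuffles a κ w) (λ {v} v∈ → cong (_+ inv v) (ab v∈)) ⟩
      q ^ e * gf inv (shuffles a κ w)
        ≡⟨ cong₂ (λ e f → q ^ e * f) (sym up) (trans sh (cong (λ n → binom κ n * q ^ inv w) len)) ⟩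
      q ^ upper a t * (binom κ (weight t) * q ^ inv w)
        ≡⟨ *-assoc (q ^ upper a t) _ _ ⟨
      q ^ upper a t * binom κ (weight t) * q ^ inv w ∎
    a-not-above-a : κ * ind (bigger a a) ≡ 0
    a-not-above-a = trans (cong (λ b → κ * ind b) (<ᵇ-false {toℕ a} ≤-refl)) (*-zeroʳ κ)
    upper-min : ∀ s → (∀ {b} → b ∈ keys s → toℕ a < toℕ b) → upper a s ≡ weight s
    upper-min s min = sum-map-cong s (λ {e} e∈ → cong (if_then suc (proj₂ e) else 0) (<ᵇ-true (min (∈-map⁺ proj₁ e∈))))
    upper-max : ∀ s → (∀ {b} → b ∈ keys s → toℕ b < toℕ a) → upper a s ≡ 0
    upper-max s max = trans
      (sum-map-cong s (λ {e} e∈ → cong (if_then suc (proj₂ e) else 0) (<ᵇ-false (<⇒≤ (max (∈-map⁺ proj₁ e∈))))))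
      (sum-map-zero s (λ _ → refl))
    step : ∀ {w} → w ∈ shuffleWords t →
      gf inv (map (a ∷_) (shuffles a κ w)) ≡ q ^ upper a t * binom κ (weight t) * q ^ inv w
    step {w} w∈ with extreme (keys t) a∉ convs
    ... | inj₁ min = finish w (length w) len (trans (upper-min t min) (sym len))
      (gf-shuffles-min a κ w (min ∘ letters w∈))
      (λ v∈ → trans (countᵇ-shuffles (bigger a) a κ w v∈)
        (cong₂ _+_ a-not-above-a (countᵇ-all (bigger a) w (<ᵇ-true ∘ min ∘ letters w∈))))
      where len = length-shuffleWords t w∈
    ... | inj₂ max = finish w 0 (length-shuffleWords t w∈) (upper-max t max)
      (gf-shuffles-max a κ w (max ∘ letters w∈))
      (λ v∈ → trans (countᵇ-shuffles (bigger a) a κ w v∈)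
        (cong₂ _+_ a-not-above-a (countᵇ-none (bigger a) w (<ᵇ-false ∘ <⇒≤ ∘ max ∘ letters w∈))))

-- The class of the theorem

allWords-length : ∀ m n {w : Word m} → w ∈ allWords m n → length w ≡ n
allWords-length m zero (here refl) = refl
allWords-length m (suc n) w∈
  with x , _ , p ← find (∈-concatMap⁻ (λ x → map (x ∷_) (allWords m n)) {allFin m} w∈)
  with v , v∈ , refl ← ∈-map⁻ (x ∷_) p = cong suc (allWords-length m n v∈)

allWords-complete : ∀ {m} (w : Word m) → w ∈ allWords m (length w)
allWords-complete [] = here refl
allWords-complete (x ∷ w) =
  ∈-concatMap⁺ _ (lose (∈-allFin x) (∈-map⁺ (x ∷_) (allWords-complete w)))

allWords-unique : ∀ m n → Unique (allWords m n)
allWords-unique m zero = [] ∷ []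
allWords-unique m (suc n) = unique-concatMap _ (Unique.allFin⁺ m)
  (λ _ → Unique.map⁺ ∷-injectiveʳ (allWords-unique m n))
  λ {x} {y} _ _ p p′ → let _ , _ , e = ∈-map⁻ (x ∷_) p ; _ , _ , e′ = ∈-map⁻ (y ∷_) p′ in
    ∷-injectiveˡ (trans (sym e) e′)

all-true⁻ : {A : Set} (p : A → Bool) (xs : List A) → all p xs ≡ true → ∀ {x} → x ∈ xs → p x ≡ true
all-true⁻ p (y ∷ xs) eq x∈ with p y in py
all-true⁻ p (y ∷ xs) eq (here refl) | true = py
all-true⁻ p (y ∷ xs) eq (there x∈)  | true = all-true⁻ p xs eq x∈

all-true⁺ : {A : Set} (p : A → Bool) (xs : List A) → (∀ x → p x ≡ true) → all p xs ≡ true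
all-true⁺ p [] _ = refl
all-true⁺ p (y ∷ xs) eq = cong₂ _∧_ (eq y) (all-true⁺ p xs eq)

eqWord⇒≡ : ∀ {m} (v w : Word m) → eqWord v w ≡ true → v ≡ w
eqWord⇒≡ [] [] _ = refl
eqWord⇒≡ (x ∷ v) (y ∷ w) eq with eqL x y in e
... | true = cong₂ _∷_ (eqL⇒≡ e) (eqWord⇒≡ v w eq)

eqWord-refl : ∀ {m} (w : Word m) → eqWord w w ≡ true
eqWord-refl [] = refl
eqWord-refl (x ∷ w) = cong₂ _∧_ (eqL-refl x) (eqWord-refl w)

∧-true⁻ : ∀ {b c} → (b ∧ c) ≡ true → b ≡ true × c ≡ true
∧-true⁻ {true} {true} _ = refl , refl

length-mult : ∀ {m} (r : Word m) → length r ≡ ΣFin m (λ a → mult a r)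
length-mult {m} [] = sym (sum-map-zero (allFin m) (λ _ → refl))
length-mult {m} (x ∷ r) = begin
  suc (length r)
    ≡⟨ cong₂ _+_ (sym (ΣFin-delta x (λ _ → 1))) (length-mult r) ⟩
  ΣFin m (λ a → ind (eqL a x)) + ΣFin m (λ a → mult a r)
    ≡⟨ sum-map-+ (allFin m) (λ a → ind (eqL a x)) (λ a → mult a r) ⟨
  ΣFin m (λ a → ind (eqL a x) + mult a r)
    ≡⟨ sum-map-cong (allFin m) (λ {a} _ → sym (countᵇ-∷ (eqL a) x r)) ⟩
  ΣFin m (λ a → mult a (x ∷ r)) ∎

-- The class as a list of reversed words

reversed : (m : ℕ) → (Fin m → ℕ) → Word m → List (Word m)
reversed m k τ = map reverse (SMτ m k τ)

reversed-unique : ∀ m k τ → Unique (reversed m k τ)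
reversed-unique m k τ = Unique.map⁺ reverse-injective (Unique.filter⁺ _ (allWords-unique m (size m k)))

mult-reverse : ∀ {m} (a : Fin m) r → mult a (reverse r) ≡ mult a r
mult-reverse a r = countᵇ-↭ (eqL a) (↭-reverse r)

reversed⁻ : ∀ {m} {k : Fin m → ℕ} {τ r} → r ∈ reversed m k τ →
  (∀ a → mult a r ≡ k a) × order r ≡ reverse τ
reversed⁻ {m} {k} {τ} r∈
  with w , w∈ , refl ← ∈-map⁻ reverse r∈
  with rearr , tail ← ∧-true⁻ (proj₂ (∈-filterᵇ⁻ (λ w → isRearr m k w ∧ eqWord (tailPerm w) τ) {xs = allWords m (size m k)} w∈)) =
  (λ a → trans (mult-reverse a w)
    (≡ᵇ⇒≡ _ _ (subst T (sym (all-true⁻ _ (allFin m) rearr (∈-allFin a))) _))) ,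
  (begin
    order (reverse w)                     ≡⟨ reverse-involutive (order (reverse w)) ⟨
    reverse (reverse (order (reverse w))) ≡⟨ cong reverse (tailPerm-reverse (reverse w)) ⟨
    reverse (tailPerm (reverse (reverse w))) ≡⟨ cong (reverse ∘ tailPerm) (reverse-involutive w) ⟩
    reverse (tailPerm w)                  ≡⟨ cong reverse (eqWord⇒≡ (tailPerm w) τ tail) ⟩
    reverse τ                             ∎)

reversed⁺ : ∀ {m} {k : Fin m → ℕ} {τ r} → (∀ a → mult a r ≡ k a) → order r ≡ reverse τ → r ∈ reversed m k τ
reversed⁺ {m} {k} {τ} {r} cont ord = subst (_∈ reversed m k τ) (reverse-involutive r)
  (∈-map⁺ reverse (∈-filterᵇ⁺ _ (subst (λ n → reverse r ∈ allWords m n) len (allWords-complete (reverse r)))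
    (cong₂ _∧_ rearr tail)))
  where
  len : length (reverse r) ≡ size m k
  len = trans (length-reverse r) (trans (length-mult r) (sum-map-cong (allFin m) (λ {a} _ → cont a)))
  rearr : isRearr m k (reverse r) ≡ true
  rearr = all-true⁺ _ (allFin m) (λ a →
    trans (cong (_≡ᵇ k a) (trans (mult-reverse a r) (cont a))) (≡ᵇ-refl (k a)))
  tail : eqWord (tailPerm (reverse r)) τ ≡ true
  tail = trans (cong (λ w → eqWord w τ) (trans (tailPerm-reverse r)
    (trans (cong reverse ord) (reverse-involutive τ)))) (eqWord-refl τ)

coeff-reversed : ∀ m k τ (stat f : Word m → ℕ) → (∀ r → stat (reverse r) ≡ f r) → ∀ e →
  coeff m k τ stat e ≡ occ e (map f (reversed m k τ))
coeff-reversed m k τ stat f eq e = sym (begin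
  occ e (map f (map reverse (SMτ m k τ)))
    ≡⟨ countᵇ-map (_≡ᵇ e) f (map reverse (SMτ m k τ)) ⟩
  countᵇ (λ r → f r ≡ᵇ e) (map reverse (SMτ m k τ))
    ≡⟨ countᵇ-map (λ r → f r ≡ᵇ e) reverse (SMτ m k τ) ⟩
  countᵇ (λ w → f (reverse w) ≡ᵇ e) (SMτ m k τ)
    ≡⟨ cong length (filterᵇ-cong (λ w → cong (_≡ᵇ e)
         (trans (sym (eq (reverse w))) (cong stat (reverse-involutive w)))) (SMτ m k τ)) ⟩
  coeff m k τ stat e ∎)

take-length-++ : {A : Set} (xs ys : List A) → take (length xs) (xs ++ ys) ≡ xs
take-length-++ [] ys = refl
take-length-++ (x ∷ xs) ys = cong (x ∷_) (take-length-++ xs ys)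

-- A tail `β` of the reversed permutation is an initial segment of τ read backwards, so the
-- hypothesis applies with i the length of `β`.
consecutive⇒convexTails : ∀ {m} {τ : Word m} → Consecutive m τ → ConvexTails (reverse τ)
consecutive⇒convexTails {m} {τ} cons = go [] (reverse τ) refl
  where
  go : ∀ α β → reverse τ ≡ α ++ β → ConvexTails β
  go α [] _ = _
  go α β@(b ∷ β′) eq =
    (λ {x} {y} {z} x∈ z∈ x≤y y≤z → member-true (reverse⁻ (subst (y ∈_) prefix
      (cons (length (reverse β)) x y z (inside x∈) (inside z∈) x≤y y≤z)))) ,
    go (α ∷ʳ b) β′ (trans eq (sym (++-assoc α (b ∷ []) β′)))
    where
    prefix : take (length (reverse β)) τ ≡ reverse β
    prefix = begin
      take (length (reverse β)) τ
        ≡⟨ cong (take (length (reverse β))) (trans (sym (reverse-involutive τ)) (trans (cong reverse eq) (reverse-++ α β))) ⟩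
      take (length (reverse β)) (reverse β ++ reverse α)
        ≡⟨ take-length-++ (reverse β) (reverse α) ⟩
      reverse β ∎
    reverse⁻ : ∀ {y} → y ∈ reverse β → y ∈ β
    reverse⁻ = ∈-resp-↭ (↭-reverse β)
    inside : ∀ {x} → member β x ≡ true → x ∈ take (length (reverse β)) τ
    inside x∈ = subst (_ ∈_) (sym prefix) (∈-resp-↭ (↭-sym (↭-reverse β)) (member⇒∈ β x∈))

module _ {m : ℕ} (k : Fin m → ℕ) (k≥1 : ∀ i → 1 ≤ k i) {τ : Word m}
         (perm : IsPerm m τ) (cons : Consecutive m τ) where

  private
    ρ : Word m
    ρ = reverse τ
    L : List (Word m)
    L = reversed m k τ
    t : Profile m
    t = profileOf k ρ
    -- Length m and the presence of all m letters make τ duplicate-free, by the pigeonhole lemma.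
    letters↭ρ : allFin m ↭ ρ
    letters↭ρ = ↭-trans
      (unique-⊆-↭ (Unique.allFin⁺ m) (λ {a} _ → proj₂ perm a)
        (≤-reflexive (trans (proj₁ perm) (sym (length-tabulate {n = m} id)))))
      (↭-sym (↭-reverse τ))
    ρ-unique : Unique ρ
    ρ-unique = AllPairs-resp-↭ (setoid _) (λ ne → ne ∘ sym) ((λ { refl → id }) , λ { refl → id })
      (↭⇒↭ₛ letters↭ρ) (Unique.allFin⁺ m)
    ρ-complete : ∀ a → a ∈ ρ
    ρ-complete a = ∈-resp-↭ letters↭ρ (∈-allFin a)
    ρ-convex : ConvexTails ρ
    ρ-convex = consecutive⇒convexTails cons
    t-unique : Unique (keys t)
    t-unique = subst Unique (sym (keys-profileOf k ρ)) ρ-unique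
    profile-L : ∀ {r} → r ∈ L → profile r ≡ t
    profile-L r∈ with cont , ord ← reversed⁻ r∈ = profile⁺ k ord cont
    L-profile : ∀ {r} → profile r ≡ t → r ∈ L
    L-profile eq with ord , cont ← profile⁻ k k≥1 ρ-complete eq = reversed⁺ cont ord

  majd~inv : ∀ c e → occ e (map (majd c) L) ≡ occ e (map inv L)
  majd~inv c e = begin
    occ e (map (majd c) L)
      ≡⟨ cong (occ e) (map-cong (inv-foata c) L) ⟨
    occ e (map (inv ∘ foata c) L)
      ≡⟨ cong (occ e) (map-∘ L) ⟩
    occ e (map inv (map (foata c) L))
      ≡⟨ countᵇ-↭ (_≡ᵇ e) (map⁺ inv (injective-self-map-↭ (foata c) (reversed-unique m k τ) (foata-injective c) closed)) ⟩
    occ e (map inv L) ∎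
    where
    closed : ∀ {r} → r ∈ L → foata c r ∈ L
    closed {r} r∈ with cont , ord ← reversed⁻ r∈ =
      reversed⁺ (λ a → trans (countᵇ-↭ (eqL a) (foata-↭ c r)) (cont a))
                (foata-order c ρ-unique ρ-complete ρ-convex ord)

  inv~zStat : ∀ e → occ e (map inv L) ≡ occ e (map zStat L)
  inv~zStat = powerSum-injective q (map inv L) (map zStat L) (short inv) (short zStat) (begin
    powerSum q (map inv L)       ≡⟨ cong sum (map-∘ L) ⟨
    gf inv L                     ≡⟨ sum-↭ (map⁺ _ L↭shuffleWords) ⟩
    gf inv (shuffleWords t)      ≡⟨ gf-inv t t-unique (subst ConvexTails (sym (keys-profileOf k ρ)) ρ-convex) ⟩
    classGF t                    ≡⟨ gf-zStat (size m k) t weight-t t-unique ⟨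
    gf zStat (words (size m k) t) ≡⟨ sum-↭ (map⁺ _ L↭words) ⟨
    gf zStat L                   ≡⟨ cong sum (map-∘ L) ⟩
    powerSum q (map zStat L)     ∎)
    where
    -- No coefficient exceeds the number of words in the class, so each one is a digit in this base.
    q = suc (length L)
    open GeneratingFunction q
    short : ∀ (f : Word m → ℕ) → length (map f L) < q
    short f = s≤s (≤-reflexive (length-map f L))
    weight-t : weight t ≡ size m k
    weight-t = begin
      weight t                           ≡⟨ cong sum (map-∘ ρ) ⟨
      sum (map (λ a → suc (pred (k a))) ρ) ≡⟨ cong sum (map-cong (λ a → suc-pred (k a) {{>-nonZero (k≥1 a)}}) ρ) ⟩
      sum (map k ρ)                      ≡⟨ sum-↭ (map⁺ k letters↭ρ) ⟨
      size m k                           ∎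
    L↭shuffleWords : L ↭ shuffleWords t
    L↭shuffleWords = unique-set-↭ (reversed-unique m k τ) (shuffleWords-unique t t-unique)
      (λ {r} r∈ → shuffleWords-complete t r (profile-L r∈))
      (λ r∈ → L-profile (shuffleWords-sound t t-unique r∈))
    L↭words : L ↭ words (size m k) t
    L↭words = unique-set-↭ (reversed-unique m k τ) (words-unique (size m k) t t-unique)
      (λ {r} r∈ → subst (λ n → r ∈ words n t)
        (trans (length-mult r) (sum-map-cong (allFin m) (λ {a} _ → proj₁ (reversed⁻ {τ = τ} r∈) a)))
        (words-complete r t (profile-L r∈)))
      (λ r∈ → L-profile (proj₁ (words-sound (size m k) t t-unique r∈)))

theorem2p3 : (m : ℕ) (k : Fin m → ℕ) → (∀ i → 1 ≤ k i) →
    (τ : Word m) → IsPerm m τ → Consecutive m τ →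
    (d : ℕ) → 1 ≤ d →
    ∀ (e : ℕ) →
    (coeff m k τ INV e ≡ coeff m k τ MAJ e)
    × (coeff m k τ MAJ e ≡ coeff m k τ (MAJd d) e)
    × (coeff m k τ (MAJd d) e ≡ coeff m k τ Z e)
theorem2p3 m k k≥1 τ perm cons (suc c) _ e =
  trans INV≡ (sym MAJ≡) , trans MAJ≡ (sym MAJd≡) , trans MAJd≡ (sym Z≡)
  where
  -- INV is the hub: the bijections link it to MAJ_d for each d, with d = 1 giving MAJ, and the
  -- product formula links it to Z.
  N = occ e (map inv (reversed m k τ))
  INV≡ : coeff m k τ INV e ≡ N
  INV≡ = coeff-reversed m k τ INV inv INV-reverse e
  MAJd≡ : coeff m k τ (MAJd (suc c)) e ≡ N
  MAJd≡ = trans (coeff-reversed m k τ (MAJd (suc c)) (majd c) (MAJd-reverse c) e)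
    (majd~inv k k≥1 perm cons c e)
  MAJ≡ : coeff m k τ MAJ e ≡ N
  MAJ≡ = trans (coeff-reversed m k τ MAJ (majd 0) (λ r → trans (MAJ≡MAJd (reverse r)) (MAJd-reverse 0 r)) e)
    (majd~inv k k≥1 perm cons 0 e)
  Z≡ : coeff m k τ Z e ≡ N
  Z≡ = trans (coeff-reversed m k τ Z zStat Z-reverse e) (sym (inv~zStat k k≥1 perm cons e))
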